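{- Let $D\ge 2$ be a squarefree integer and $K=\mathbb{Q}(\sqrt{D})$ with ring of integers $\mathcal{O}_K$. Then for every $a\in\mathbb{Z}$ there exist $z,w\in\mathcal{O}_K$ such that $z\tau(z)+w\tau(w)=a$.
   Context: $\tau: K\to K$ is the nontrivial automorphism $a+b\sqrt{D}\mapsto a-b\sqrt{D}$. -}

module Defs where

open import Data.Nat as ℕ using (ℕ; zero; suc)
open import Data.Nat.Divisibility using (_∣_)
open import Data.Nat.Primality using (Prime)
open import Data.Integer as ℤ using (ℤ)
open import Data.Rational as ℚ using (ℚ; 0ℚ; 1ℚ)
open import Data.Fin using (Fin; zero; suc)
open import Data.Product using (_×_; _,_; ∃-syntax)
open import Relation.Nullary using (¬_)
open import Relation.Binary.PropositionalEquality using (_≡_)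

SquareFree : ℕ → Set
SquareFree D = ∀ p → Prime p → ¬ ((p ℕ.* p) ∣ D)

ℤ→ℚ : ℤ → ℚ
ℤ→ℚ n = n ℚ./ 1

-- K = ℚ(√D), an element (a , b) represents a + b √D
K : Set
K = ℚ × ℚ

module QuadField (D : ℕ) where

  Dℚ : ℚ
  Dℚ = ℤ→ℚ (ℤ.+ D)

  fromℚ : ℚ → K
  fromℚ q = q , 0ℚ

  0K 1K : K
  0K = fromℚ 0ℚ
  1K = fromℚ 1ℚ

  _+K_ : K → K → K
  (a , b) +K (c , d) = (a ℚ.+ c) , (b ℚ.+ d)

  _*K_ : K → K → K
  (a , b) *K (c , d) = ((a ℚ.* c) ℚ.+ (Dℚ ℚ.* (b ℚ.* d))) , ((a ℚ.* d) ℚ.+ (b ℚ.* c))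

  τ : K → K
  τ (a , b) = a , ℚ.- b

  _^K_ : K → ℕ → K
  z ^K zero = 1K
  z ^K suc n = z *K (z ^K n)

  polySum : (n : ℕ) → (Fin n → ℤ) → K → K
  polySum zero c z = 0K
  polySum (suc n) c z = (fromℚ (ℤ→ℚ (c zero)) *K (z ^K 0)) +K
                        (z *K polySum n (λ i → c (suc i)) z)

  IsAlgInt : K → Set
  IsAlgInt z = ∃[ n ] ∃[ c ] ((z ^K n) +K polySum n c z) ≡ 0K

  O-K : Set
  O-K = Data.Product.Σ K IsAlgInt

{-# OPTIONS --safe #-}
module Submission where

-- With z = x + y√D and w = u + v√D the sum of norms is N(α) − D N(β) for the Gaussian integers
-- α = x + ui, β = y + vi: the reduced norm of α + βj in the order R = ℤ[i] + ℤ[i]j, j² = D.  It is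
-- multiplicative, and only this order is needed.
--
-- Let ℓ = ππ̄ be an odd prime not dividing D.  A solution of T² − DU² = 1 with ℓ ∣ U gives units
-- T + δj with N(δ) = U², and replacing each factor ℓ of U by π² or π̄² in δ makes them nontrivial
-- unipotents mod π.  Moving α + βj by them one reaches ℓ ∣ N(β) without changing the norm.  So values
-- of the form may be divided by ℓ, and they are also values of the form for Dℓ.
--
-- By a Legendre descent every a ≠ 0 satisfies N(α) − D N(β) = a N(γ) with γ ≠ 0.  If D is odd and all
-- its primes are inert in ℤ[i], the factor N(γ) can be removed for odd a: split primes by the above,
-- while a factor p² with p inert (or a power of 2) is first traded, along a line on the quadric, for a
-- sum of two coprime squares.  The prime 2 and the split primes of D are put back one at a time.

open import Defs
open import Data.Nat using (ℕ; _≥_)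
open import Data.Integer using (ℤ)
open import Data.Product using (∃-syntax; _×_)
open import Relation.Binary.PropositionalEquality using (_≡_)

open import Data.Nat as ℕ using (zero; suc)
import Data.Nat.Properties as ℕ
import Data.Nat.Divisibility as ℕᵈ
open import Data.Nat.Coprimality using (Coprime; coprime-Bézout)
open import Data.Nat.GCD using (module Bézout)
open import Data.Nat.Induction using (<-rec)
open import Data.Nat.ListAction using (product)
open import Data.Nat.Primality using (Prime; prime?; euclidsLemma; prime⇒irreducible; prime⇒nonZero; prime⇒nonTrivial; prime[2]; ¬prime[0]; ¬prime[1])
open import Data.Nat.Primality.Factorisation using (factorise; PrimeFactorisation)
open import Data.Fin as Fin using (Fin; combine; fromℕ<; toℕ; splitAt)
import Data.Fin.Properties as Fin
open import Data.List.Base using ([]; _∷_)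
open import Data.List.Relation.Unary.All using (All; []; _∷_)
open import Data.Sign as Sign using (Sign)
open import Data.Integer hiding (suc; ℤ; _≥_)
open import Data.Integer.Properties
open import Data.Integer.DivMod using (a≡a%ℕn+[a/ℕn]*n; n%ℕd<d)
open import Data.Integer.Divisibility.Signed
open import Data.Integer.Tactic.RingSolver using (solve-∀)
import Data.Rational as ℚ
import Data.Rational.Properties as ℚ
open import Data.Rational.Unnormalised using (mkℚᵘ; *≡*)
import Data.Rational.Unnormalised.Properties as ℚᵘ
open import Data.Empty using (⊥)
open import Data.Product using (∃; ∃₂; _,_; proj₁; proj₂)
open import Data.Sum using (_⊎_; inj₁; inj₂)
open import Relation.Binary.Definitions using (tri<; tri≈; tri>)
open import Relation.Nullary using (¬_; Dec; yes; no; contradiction; ¬?; _×-dec_)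
import Relation.Nullary.Decidable as Dec
open import Relation.Binary.PropositionalEquality using (_≢_; refl; sym; trans; cong; cong₂; subst; module ≡-Reasoning)

-- The descent yields a only as the reduced norm of a quaternion with a denominator γ; integrality
-- is the real difficulty. For an indefinite quaternion algebra it is usually strong approximation
-- that clears denominators, and the unipotents built from Pell's equation are its explicit
-- substitute at one prime ℓ. Their condition ℓ ∤ D dictates the order of the proof: a split prime
-- of D could not be divided out of N(γ) in this way, so D is first stripped to its inert primes,
-- the denominator is cleared there, and only then do the split primes return to D. The power of 2
-- in N(γ) needs its own argument, which wants a odd; even a cost nothing at the end, since 2 = N(1
-- + i) is itself a value.

-- Divisibility and Bézout in ℤ

∣-lin : ∀ {k a b n} u v → k ∣ a → k ∣ b → n ≡ u * a + v * b → k ∣ n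
∣-lin {k} u v (divides s refl) (divides t refl) eq =
  divides (u * s + v * t) (trans eq (lem k u v s t))
  where
  lem : ∀ k u v s t → u * (s * k) + v * (t * k) ≡ (u * s + v * t) * k
  lem = solve-∀

∣-mul : ∀ {k a n} u → k ∣ a → n ≡ u * a → k ∣ n
∣-mul {k} u (divides s refl) eq = divides (u * s) (trans eq (sym (*-assoc u s k)))

euclid : ∀ {p} → Prime p → ∀ a b → + p ∣ a * b → (+ p ∣ a) ⊎ (+ p ∣ b)
euclid {p} pr a b d
  with euclidsLemma ∣ a ∣ ∣ b ∣ pr (subst (p ℕᵈ.∣_) (abs-* a b) (∣⇒∣ᵤ d))
... | inj₁ h = inj₁ (∣ᵤ⇒∣ h)
... | inj₂ h = inj₂ (∣ᵤ⇒∣ h)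

euclid-square : ∀ {p} → Prime p → ∀ a → + p ∣ a * a → + p ∣ a
euclid-square pr a d with euclid pr a a d
... | inj₁ h = h
... | inj₂ h = h

prime∤1 : ∀ {p} → Prime p → ¬ + p ∣ 1ℤ
prime∤1 pr d = ¬prime[1] (subst Prime (ℕᵈ.∣1⇒≡1 (∣⇒∣ᵤ d)) pr)

prime≢0 : ∀ {p} → Prime p → + p ≢ 0ℤ
prime≢0 pr eq = ℕ.≢-nonZero⁻¹ _ {{prime⇒nonZero pr}} (+-injective eq)

cancelˡ : ∀ k {a b} → k ≢ 0ℤ → k * a ≡ k * b → a ≡ b
cancelˡ k k≢0 eq = *-cancelˡ-≡ k _ _ {{≢-nonZero k≢0}} eq

-- Moves the sign of `a` onto the coefficient, so that a Bézout identity for absolute values becomes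
-- one for integers.
_⋆_ : ℕ → ℤ → ℤ
x ⋆ a = + x * (sign a ◃ 1)

⋆-abs : ∀ x a → x ⋆ a * a ≡ + (x ℕ.* ∣ a ∣)
⋆-abs x (+ n) = trans (cong (_* + n) (*-identityʳ (+ x))) (sym (pos-* x n))
⋆-abs x -[1+ n ] = trans (lem (+ x) (+ suc n)) (sym (pos-* x (suc n)))
  where
  lem : ∀ x n → x * - 1ℤ * (- n) ≡ x * n
  lem = solve-∀

⋆-diff : ∀ x a y b → suc (y ℕ.* ∣ b ∣) ≡ x ℕ.* ∣ a ∣ → x ⋆ a * a - y ⋆ b * b ≡ 1ℤ
⋆-diff x a y b eq = trans (cong₂ _-_ (trans (⋆-abs x a) (cong +_ (sym eq))) (⋆-abs y b)) (lem₂ (+ (y ℕ.* ∣ b ∣)))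
  where
  lem₂ : ∀ t → 1ℤ + t - t ≡ 1ℤ
  lem₂ = solve-∀

bezout : ∀ a b → Coprime ∣ a ∣ ∣ b ∣ → ∃₂ λ u v → u * a + v * b ≡ 1ℤ
bezout a b cop with coprime-Bézout cop
... | Bézout.+- x y eq = x ⋆ a , - (y ⋆ b) , trans (lem₁ (x ⋆ a * a) (y ⋆ b) b) (⋆-diff x a y b eq)
  where
  lem₁ : ∀ s t b → s + - t * b ≡ s - t * b
  lem₁ = solve-∀
... | Bézout.-+ x y eq = - (x ⋆ a) , y ⋆ b , trans (lem₁ (x ⋆ a) a (y ⋆ b * b)) (⋆-diff y b x a eq)
  where
  lem₁ : ∀ s a t → - s * a + t ≡ t - s * a
  lem₁ = solve-∀
prime-coprime : ∀ {p n} → Prime p → ¬ p ℕᵈ.∣ n → Coprime p n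
prime-coprime pr p∤n (d∣p , d∣n) with prime⇒irreducible pr d∣p
... | inj₁ d≡1 = d≡1
... | inj₂ refl = contradiction d∣n p∤n

inverse : ∀ {p} → Prime p → ∀ a → ¬ + p ∣ a → ∃ λ b → + p ∣ a * b - 1ℤ
inverse {p} pr a p∤a
  with u , v , eq ← bezout (+ p) a (prime-coprime pr (λ d → p∤a (∣ᵤ⇒∣ d)))
  = v , divides (- u) (trans (cong (λ t → a * v - t) (sym eq)) (lem (+ p) a u v))
  where
  lem : ∀ p a u v → a * v - (u * p + v * a) ≡ - u * p
  lem = solve-∀

-- Gaussian integers; (x , y) is x + y i.

G : Set
G = ℤ × ℤ

N : G → ℤ
N (x , y) = x * x + y * y

infixl 7 _⊗_
_⊗_ : G → G → G
(a , b) ⊗ (c , d) = a * c - b * d , a * d + b * c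

conj : G → G
conj (x , y) = x , - y

N-⊗ : ∀ z w → N (z ⊗ w) ≡ N z * N w
N-⊗ (a , b) (c , d) = lem a b c d
  where
  lem : ∀ a b c d → (a * c - b * d) * (a * c - b * d) + (a * d + b * c) * (a * d + b * c)
        ≡ (a * a + b * b) * (c * c + d * d)
  lem = solve-∀

N-swap : ∀ x y → N (x , y) ≡ N (y , x)
N-swap x y = +-comm (x * x) (y * y)

N-scale : ∀ t z → N ((t , 0ℤ) ⊗ z) ≡ t * t * N z
N-scale t (x , y) = lem t x y
  where
  lem : ∀ t x y → (t * x - 0ℤ * y) * (t * x - 0ℤ * y) + (t * y + 0ℤ * x) * (t * y + 0ℤ * x)
        ≡ t * t * (x * x + y * y)
  lem = solve-∀

N-conj : ∀ z → N (conj z) ≡ N z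
N-conj (x , y) = lem x y
  where
  lem : ∀ x y → x * x + - y * - y ≡ x * x + y * y
  lem = solve-∀

-- With π = c + di, the coordinates of zπ̄ are, up to sign, xc + yd and xd - yc, and their squares
-- add up to p N(z). So p divides both as soon as it divides the first, and up to conjugation `w` is
-- zπ̄ / p = z / π.
split-norm-aux : ∀ {p} → Prime p → ∀ c d x y → + p ≡ N (c , d) →
  + p ∣ x * c + y * d → ∃ λ w → N (x , y) ≡ + p * N w
split-norm-aux {p} pr c d x y p≡ p∣s@(divides u equ) = go (euclid-square pr (x * d - y * c)
    (∣-lin (N (x , y)) (- (x * c + y * d)) (∣-reflexive p≡) p∣s (lem x y c d)))
  where
  lem : ∀ x y c d → (x * d - y * c) * (x * d - y * c) ≡
        (x * x + y * y) * (c * c + d * d) + (- (x * c + y * d)) * (x * c + y * d)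
  lem = solve-∀
  lem₂ : ∀ x y c d → (c * c + d * d) * (x * x + y * y) ≡
        (x * c + y * d) * (x * c + y * d) + (x * d - y * c) * (x * d - y * c)
  lem₂ = solve-∀
  lem₃ : ∀ u v p → u * p * (u * p) + v * p * (v * p) ≡ p * (p * (u * u + v * v))
  lem₃ = solve-∀
  go : + p ∣ x * d - y * c → ∃ λ w → N (x , y) ≡ + p * N w
  go (divides v eqv) = (u , v) , cancelˡ (+ p) (prime≢0 pr) (begin
    + p * N (x , y)     ≡⟨ cong (_* N (x , y)) p≡ ⟩
    N (c , d) * N (x , y) ≡⟨ lem₂ x y c d ⟩
    (x * c + y * d) * (x * c + y * d) + (x * d - y * c) * (x * d - y * c) ≡⟨ cong₂ (λ s t → s * s + t * t) equ eqv ⟩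
    u * + p * (u * + p) + v * + p * (v * + p) ≡⟨ lem₃ u v (+ p) ⟩
    + p * (+ p * N (u , v)) ∎)
    where open ≡-Reasoning

-- (xc + yd)(xc - yd) = x² N(π) - d² N(z), so z is divisible by π or by π̄.
split-norm : ∀ {p} → Prime p → ∀ π z → + p ≡ N π → + p ∣ N z → ∃ λ w → N z ≡ + p * N w
split-norm {p} pr (c , d) (x , y) p≡ p∣N = go (euclid pr (x * c + y * d) (x * c + y * - d)
    (∣-lin (x * x) (- (d * d)) (∣-reflexive p≡) p∣N (lem x y c d)))
  where
  lem : ∀ x y c d → (x * c + y * d) * (x * c + y * - d) ≡
        x * x * (c * c + d * d) + - (d * d) * (x * x + y * y)
  lem = solve-∀
  go : (+ p ∣ x * c + y * d) ⊎ (+ p ∣ x * c + y * - d) → ∃ λ w → N (x , y) ≡ + p * N w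
  go (inj₁ h) = split-norm-aux pr c d x y p≡ h
  go (inj₂ h) = split-norm-aux pr c (- d) x y (trans p≡ (sym (N-conj (c , d)))) h

N≥0 : ∀ z → 0ℤ ≤ N z
N≥0 (x , y) = +-mono-≤ (sq x) (sq y)
  where
  sq : ∀ x → 0ℤ ≤ x * x
  sq (+ n) = subst (0ℤ ≤_) (pos-* n n) (+≤+ ℕ.z≤n)
  sq -[1+ n ] = +≤+ ℕ.z≤n

%-reduce : ∀ {p} .{{_ : ℕ.NonZero p}} r → + p ∣ r * r + 1ℤ → + p ∣ + (r %ℕ p) * + (r %ℕ p) + 1ℤ
%-reduce {p} r p∣ = ∣-lin 1ℤ (- q * (+ s + r)) p∣ (∣-refl {+ p})
      (trans (lem (+ s) q (+ p)) (cong (λ t → 1ℤ * (t * t + 1ℤ) + - q * (+ s + t) * + p) (sym r≡)))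
  where
  s = r %ℕ p
  q = r /ℕ p
  r≡ : r ≡ + s + q * + p
  r≡ = a≡a%ℕn+[a/ℕn]*n r p
  lem : ∀ s q n → s * s + 1ℤ ≡
    1ℤ * ((s + q * n) * (s + q * n) + 1ℤ) + - q * (s + (s + q * n)) * n
  lem = solve-∀

-- Descent step: a divisor of s + i of norm m is exchanged for its cofactor, of norm n.
divisor-step : ∀ n m s q r → r ≡ + s + q * + n → ℕ.suc (s ℕ.* s) ≡ m ℕ.* n → + m ≢ 0ℤ →
  (∃₂ λ z w → z ⊗ w ≡ (+ s , 1ℤ) × N z ≡ + m) → ∃₂ λ z w → z ⊗ w ≡ (r , 1ℤ) × N z ≡ + n
divisor-step n m s q r r≡ eq m≢0 ((c , d) , (a , b) , zw , Nz) =
  (a , b) , (c + q * a , d - q * b) , cong₂ _,_ eq₁ eq₂ , Nw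
  where
  open ≡-Reasoning
  Nw : N (a , b) ≡ + n
  Nw = cancelˡ (+ m) m≢0 (begin
    + m * N (a , b)        ≡⟨ cong (_* N (a , b)) (sym Nz) ⟩
    N (c , d) * N (a , b)  ≡⟨ sym (N-⊗ (c , d) (a , b)) ⟩
    N ((c , d) ⊗ (a , b))  ≡⟨ cong N zw ⟩
    + s * + s + 1ℤ         ≡⟨ cong (_+ 1ℤ) (sym (pos-* s s)) ⟩
    + (s ℕ.* s) + 1ℤ       ≡⟨ +-comm (+ (s ℕ.* s)) 1ℤ ⟩
    + suc (s ℕ.* s)        ≡⟨ cong +_ eq ⟩
    + (m ℕ.* n)            ≡⟨ pos-* m n ⟩
    + m * + n              ∎)
  lem₁ : ∀ a b c d q → a * (c + q * a) - b * (d - q * b) ≡ (c * a - d * b) + q * (a * a + b * b)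
  lem₁ = solve-∀
  lem₂ : ∀ a b c d q → a * (d - q * b) + b * (c + q * a) ≡ c * b + d * a
  lem₂ = solve-∀
  eq₁ : a * (c + q * a) - b * (d - q * b) ≡ r
  eq₁ = trans (lem₁ a b c d q) (trans (cong₂ (λ s t → s + q * t) (cong proj₁ zw) Nw) (sym r≡))
  eq₂ : a * (d - q * b) + b * (c + q * a) ≡ 1ℤ
  eq₂ = trans (lem₂ a b c d q) (cong proj₂ zw)

quotient-small : ∀ k s m → s ℕ.≤ suc k → suc (s ℕ.* s) ≡ m ℕ.* suc (suc k) → m ℕ.< suc (suc k)
quotient-small k s m s≤ eq = ℕ.*-cancelʳ-< (suc (suc k)) m (suc (suc k)) (begin-strict
  m ℕ.* suc (suc k)                 ≡⟨ sym eq ⟩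
  suc (s ℕ.* s)                     ≤⟨ ℕ.s≤s (ℕ.*-mono-≤ s≤ s≤) ⟩
  suc (suc k ℕ.* suc k)             <⟨ ℕ.s≤s (ℕ.s≤s (ℕ.≤-trans (ℕ.*-monoʳ-≤ (suc k) (ℕ.n≤1+n (suc k))) (ℕ.m≤n+m _ k))) ⟩
  suc (suc k) ℕ.* suc (suc k)       ∎)
  where open ℕ.≤-Reasoning

DivisorOf : ℕ → Set
DivisorOf n = ∀ r → + n ∣ r * r + 1ℤ → ∃₂ λ z w → z ⊗ w ≡ (r , 1ℤ) × N z ≡ + n

-- A descent in place of Gaussian gcds. For s = r mod n the cofactor m of n in s² + 1 is smaller
-- than n, so s + i = zw with N(z) = m and N(w) = n; then w(z + q w̄) = s + i + qn = r + i.
-- Composite n are included because m may be composite.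
divisor-of-r+i : ∀ n → .{{ℕ.NonZero n}} → DivisorOf n
divisor-of-r+i (suc n) = <-rec (λ n → DivisorOf (suc n)) step n
  where
  step : ∀ n → (∀ {m} → m ℕ.< n → DivisorOf (suc m)) → DivisorOf (suc n)
  step zero rec r _ = (1ℤ , 0ℤ) , (r , 1ℤ) , cong₂ _,_ (lem₁ r) refl , refl
    where
    lem₁ : ∀ r → 1ℤ * r - 0ℤ * 1ℤ ≡ r
    lem₁ = solve-∀
  step n@(suc k) rec r n∣ = go (r %ℕ suc n) (r /ℕ suc n) (a≡a%ℕn+[a/ℕn]*n r (suc n)) (n%ℕd<d r (suc n)) (%-reduce r n∣)
    where
    s²+1 : ∀ s → + s * + s + 1ℤ ≡ + suc (s ℕ.* s)
    s²+1 s = trans (cong (_+ 1ℤ) (sym (pos-* s s))) (+-comm (+ (s ℕ.* s)) 1ℤ)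
    go : ∀ s q → r ≡ + s + q * + suc n → s ℕ.< suc n → + suc n ∣ + s * + s + 1ℤ → _
    go s q r≡ s< n∣s with ∣⇒∣ᵤ (subst (+ suc n ∣_) (s²+1 s) n∣s)
    ... | ℕᵈ.divides zero ()
    ... | ℕᵈ.divides (suc m) eq = divisor-step (suc n) (suc m) s q r r≡ eq (λ ())
      (rec (ℕ.≤-pred (quotient-small k s (suc m) (ℕ.≤-pred s<) eq)) (+ s)
        (subst (+ suc m ∣_) (sym (s²+1 s)) (∣ᵤ⇒∣ (ℕᵈ.divides (suc n) (trans eq (ℕ.*-comm (suc m) (suc n)))))))

-- This includes p = 2.
Split : ℕ → Set
Split p = ∃ λ r → + p ∣ r * r + 1ℤ

split? : ∀ p → .{{ℕ.NonZero p}} → Dec (Split p)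
split? p = Dec.map′ (λ { (s , _ , d) → + s , d }) (λ { (r , d) → r %ℕ p , n%ℕd<d r p , %-reduce r d })
  (ℕ.anyUpTo? (λ s → + p ∣? + s * + s + 1ℤ) p)

-- The root of -1 is x / y modulo p.
ratio-split : ∀ {p} → Prime p → ∀ x y → + p ∣ N (x , y) → ¬ + p ∣ y → Split p
ratio-split {p} pr x y p∣N p∤y = go (inverse pr y p∤y)
  where
  go : ∃ (λ b → + p ∣ y * b - 1ℤ) → Split p
  go (b , p∣) = x * b , ∣-lin (b * b) (- (y * b + 1ℤ)) p∣N p∣ (lem x y b)
    where
    lem : ∀ x y b → x * b * (x * b) + 1ℤ ≡ b * b * (x * x + y * y) + - (y * b + 1ℤ) * (y * b - 1ℤ)
    lem = solve-∀

inert-norm : ∀ {p} → Prime p → ¬ Split p → ∀ x y → + p ∣ N (x , y) → (+ p ∣ x) × (+ p ∣ y)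
inert-norm {p} pr ns x y p∣N = go y x (subst (+ p ∣_) (N-swap x y) p∣N) , go x y p∣N
  where
  go : ∀ x y → + p ∣ N (x , y) → + p ∣ y
  go x y p∣N with + p ∣? y
  ... | yes h = h
  ... | no h = contradiction (ratio-split pr x y p∣N h) ns

split⇒norm : ∀ {p} → .{{ℕ.NonZero p}} → Split p → ∃ λ z → + p ≡ N z
split⇒norm {p} (r , d) with z , _ , _ , Nz ← divisor-of-r+i p r d = z , sym Nz

-- Pell's equation

-- Non-squareness put as anisotropy of x² - d y²: this is what the river argument uses, and it
-- passes directly from d to dℓ².
NonSquare : ℤ → Set
NonSquare d = ∀ x y → x * x ≡ d * (y * y) → y ≡ 0ℤ

value : ℤ → ℕ → ℕ → ℤ
value d x y = + x * + x - d * (+ y * + y)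

-- A basis of ℤ² on which x² − d y² takes a positive and a negative value
-- (an edge of the river in Conway's topograph).
record Edge (d : ℤ) : Set where
  field
    x₁ y₁ x₂ y₂ : ℕ
    det : + x₁ * + y₂ - + x₂ * + y₁ ≡ 1ℤ
    A>0 : 0ℤ < value d x₁ y₁
    C<0 : value d x₂ y₂ < 0ℤ
  A B C : ℤ
  A = value d x₁ y₁
  B = + x₁ * + x₂ - d * (+ y₁ * + y₂)
  C = value d x₂ y₂
  size : ℕ
  size = (x₁ ℕ.+ y₁) ℕ.+ (x₂ ℕ.+ y₂)

module _ (d : ℤ) (nonsq : NonSquare d) where

  open Edge

  det-v₁≢0 : ∀ x₁ y₁ x₂ y₂ → + x₁ * + y₂ - + x₂ * + y₁ ≡ 1ℤ → 0 ℕ.< x₁ ℕ.+ y₁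
  det-v₁≢0 (suc x) y x₂ y₂ _ = ℕ.z<s
  det-v₁≢0 zero (suc y) x₂ y₂ _ = ℕ.z<s
  det-v₁≢0 zero zero x₂ y₂ eq = contradiction (trans (sym (lem (+ x₂) (+ y₂))) eq) λ ()
    where
    lem : ∀ x y → 0ℤ * y - x * 0ℤ ≡ 0ℤ
    lem = solve-∀

  det-v₂≢0 : ∀ x₁ y₁ x₂ y₂ → + x₁ * + y₂ - + x₂ * + y₁ ≡ 1ℤ → 0 ℕ.< x₂ ℕ.+ y₂
  det-v₂≢0 x₁ y₁ (suc x) y _ = ℕ.z<s
  det-v₂≢0 x₁ y₁ zero (suc y) _ = ℕ.z<s
  det-v₂≢0 x₁ y₁ zero zero eq = contradiction (trans (sym (lem (+ x₁) (+ y₁))) eq) λ ()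
    where
    lem : ∀ x y → x * 0ℤ - 0ℤ * y ≡ 0ℤ
    lem = solve-∀

  det₁ : ∀ x₁ y₁ x₂ y₂ → (x₁ + x₂) * y₂ - x₂ * (y₁ + y₂) ≡ x₁ * y₂ - x₂ * y₁
  det₁ = solve-∀
  det₂ : ∀ x₁ y₁ x₂ y₂ → x₁ * (y₁ + y₂) - (x₁ + x₂) * y₁ ≡ x₁ * y₂ - x₂ * y₁
  det₂ = solve-∀

  replace₁ : (e : Edge d) → 0ℤ < value d (x₁ e ℕ.+ x₂ e) (y₁ e ℕ.+ y₂ e) →
    ∃ λ (e′ : Edge d) → size e ℕ.< size e′
  replace₁ e pos = record
    { x₁ = x₁ e ℕ.+ x₂ e ; y₁ = y₁ e ℕ.+ y₂ e ; x₂ = x₂ e ; y₂ = y₂ e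
    ; det = trans (det₁ (+ x₁ e) (+ y₁ e) (+ x₂ e) (+ y₂ e)) (det e)
    ; A>0 = pos ; C<0 = C<0 e } ,
    ℕ.+-monoˡ-< (x₂ e ℕ.+ y₂ e) (subst (x₁ e ℕ.+ y₁ e ℕ.<_) (shuffle (x₁ e) (y₁ e) (x₂ e) (y₂ e))
      (ℕ.m<m+n (x₁ e ℕ.+ y₁ e) (det-v₂≢0 (x₁ e) (y₁ e) (x₂ e) (y₂ e) (det e))))
    where
    shuffle : ∀ a b c d → (a ℕ.+ b) ℕ.+ (c ℕ.+ d) ≡ (a ℕ.+ c) ℕ.+ (b ℕ.+ d)
    shuffle a b c d = +-injective (lem (+ a) (+ b) (+ c) (+ d))
      where
      lem : ∀ a b c d → (a + b) + (c + d) ≡ (a + c) + (b + d)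
      lem = solve-∀

  replace₂ : (e : Edge d) → value d (x₁ e ℕ.+ x₂ e) (y₁ e ℕ.+ y₂ e) < 0ℤ →
    ∃ λ (e′ : Edge d) → size e ℕ.< size e′
  replace₂ e neg = record
    { x₁ = x₁ e ; y₁ = y₁ e ; x₂ = x₁ e ℕ.+ x₂ e ; y₂ = y₁ e ℕ.+ y₂ e
    ; det = trans (det₂ (+ x₁ e) (+ y₁ e) (+ x₂ e) (+ y₂ e)) (det e)
    ; A>0 = A>0 e ; C<0 = neg } ,
    ℕ.+-monoʳ-< (x₁ e ℕ.+ y₁ e) (subst (x₂ e ℕ.+ y₂ e ℕ.<_) (shuffle (x₁ e) (y₁ e) (x₂ e) (y₂ e))
      (ℕ.m<m+n (x₂ e ℕ.+ y₂ e) (det-v₁≢0 (x₁ e) (y₁ e) (x₂ e) (y₂ e) (det e))))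
    where
    shuffle : ∀ a b c d → (c ℕ.+ d) ℕ.+ (a ℕ.+ b) ≡ (a ℕ.+ c) ℕ.+ (b ℕ.+ d)
    shuffle a b c d = +-injective (lem (+ a) (+ b) (+ c) (+ d))
      where
      lem : ∀ a b c d → (c + d) + (a + b) ≡ (a + c) + (b + d)
      lem = solve-∀

  -- By anisotropy a zero value makes v₁ + v₂ the zero vector, which no basis allows.
  no-zero : ∀ x₁ y₁ x₂ y₂ → + x₁ * + y₂ - + x₂ * + y₁ ≡ 1ℤ →
    + (x₁ ℕ.+ x₂) * + (x₁ ℕ.+ x₂) - d * (+ (y₁ ℕ.+ y₂) * + (y₁ ℕ.+ y₂)) ≢ 0ℤ
  no-zero x₁ y₁ x₂ y₂ det eq = contradiction (trans (sym vanish) det) λ ()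
    where
    sq : + (x₁ ℕ.+ x₂) * + (x₁ ℕ.+ x₂) ≡ d * (+ (y₁ ℕ.+ y₂) * + (y₁ ℕ.+ y₂))
    sq = i-j≡0⇒i≡j (+ (x₁ ℕ.+ x₂) * + (x₁ ℕ.+ x₂)) (d * (+ (y₁ ℕ.+ y₂) * + (y₁ ℕ.+ y₂))) eq
    y≡0 : + y₁ + + y₂ ≡ 0ℤ
    y≡0 = nonsq (+ (x₁ ℕ.+ x₂)) (+ (y₁ ℕ.+ y₂)) sq
    x²≡0 : (+ x₁ + + x₂) * (+ x₁ + + x₂) ≡ 0ℤ
    x²≡0 = trans sq (trans (cong (λ t → d * (t * t)) y≡0) (*-zeroʳ d))
    x≡0 : + x₁ + + x₂ ≡ 0ℤ
    x≡0 with i*j≡0⇒i≡0∨j≡0 (+ (x₁ ℕ.+ x₂)) x²≡0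
    ... | inj₁ h = h
    ... | inj₂ h = h
    lem : ∀ x₁ y₁ x₂ y₂ → x₁ * y₂ - x₂ * y₁ ≡ x₁ * (y₁ + y₂) - (x₁ + x₂) * y₁
    lem = solve-∀
    lem₂ : ∀ x y → x * 0ℤ - 0ℤ * y ≡ 0ℤ
    lem₂ = solve-∀
    vanish : + x₁ * + y₂ - + x₂ * + y₁ ≡ 0ℤ
    vanish = trans (lem (+ x₁) (+ y₁) (+ x₂) (+ y₂)) (trans (cong₂ (λ s t → + x₁ * s - t * + y₁) y≡0 x≡0) (lem₂ (+ x₁) (+ y₁)))

  -- One step along the river: v₁ + v₂ replaces the basis vector whose value has the same sign.
  -- Coordinates are natural numbers, so `size` grows strictly and no edge recurs.
  next : (e : Edge d) → ∃ λ (e′ : Edge d) → size e ℕ.< size e′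
  next e = go (<-cmp 0ℤ (value d (x₁ e ℕ.+ x₂ e) (y₁ e ℕ.+ y₂ e)))
    where
    go : _ → _
    go (tri< pos _ _) = replace₁ e pos
    go (tri≈ _ eq _) = contradiction (sym eq) (no-zero (x₁ e) (y₁ e) (x₂ e) (y₂ e) (det e))
    go (tri> _ _ neg) = replace₂ e neg

  iter : Edge d → ℕ → Edge d
  iter e zero = e
  iter e (suc n) = proj₁ (next (iter e n))

  iter-size : ∀ e m k → size (iter e m) ℕ.< size (iter e (suc k ℕ.+ m))
  iter-size e m zero = proj₂ (next (iter e m))
  iter-size e m (suc k) = ℕ.<-trans (iter-size e m k) (proj₂ (next (iter e (suc k ℕ.+ m))))

  iter-mono : ∀ e {m n} → m ℕ.< n → size (iter e m) ℕ.< size (iter e n)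
  iter-mono e {m} {n} m<n = subst (λ t → size (iter e m) ℕ.< size (iter e t))
    (trans (sym (ℕ.+-suc k m)) (ℕ.m∸n+n≡m m<n)) (iter-size e m k)
    where k = n ℕ.∸ suc m

  -- B² - AC equals d times the squared determinant. As A and -C are positive, d leaves only
  -- finitely many triples (A, B, C).
  discriminant : ∀ (e : Edge d) → B e * B e + A e * (- C e) ≡ d
  discriminant e = trans (lem d (+ x₁ e) (+ y₁ e) (+ x₂ e) (+ y₂ e))
    (trans (cong (λ t → d * (t * t)) (det e)) (*-identityʳ d))
    where
    lem : ∀ d x₁ y₁ x₂ y₂ →
      (x₁ * x₂ - d * (y₁ * y₂)) * (x₁ * x₂ - d * (y₁ * y₂)) + (x₁ * x₁ - d * (y₁ * y₁)) * (- (x₂ * x₂ - d * (y₂ * y₂)))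
      ≡ d * ((x₁ * y₂ - x₂ * y₁) * (x₁ * y₂ - x₂ * y₁))
    lem = solve-∀

  SameForm : Edge d → Edge d → Set
  SameForm e e′ = A e ≡ A e′ × B e ≡ B e′ × C e ≡ C e′

  -- Two bases with the same Gram matrix differ by an isometry of x² - d y² of determinant 1. Its
  -- first column (T, U) has value 1. If U = 0, the isometry is ±1; then the bases agree,
  -- coordinates being natural numbers, against the growth of `size`.
  same-form-solution : ∀ e e′ → SameForm e e′ → size e ℕ.< size e′ →
    ∃₂ λ T U → T * T - d * (U * U) ≡ 1ℤ × U ≢ 0ℤ
  same-form-solution e e′ (A≡ , B≡ , C≡) size< = T , U , pell , U≢0
    where
    a = + x₁ e
    b = + y₁ e
    s = + x₂ e
    t = + y₂ e
    a′ = + x₁ e′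
    b′ = + y₁ e′
    s′ = + x₂ e′
    t′ = + y₂ e′
    T U W Z : ℤ
    -- The matrix of `e′` times the inverse of the matrix of `e`, with columns (T, U) and (W, Z).
    T = t * a′ - b * s′
    U = t * b′ - b * t′
    W = a * s′ - s * a′
    Z = a * t′ - s * b′
    lem₁ : ∀ d a b s t a′ b′ s′ t′ →
      (t * a′ - b * s′) * (t * a′ - b * s′) - d * ((t * b′ - b * t′) * (t * b′ - b * t′)) ≡
      t * t * (a′ * a′ - d * (b′ * b′)) - (t * b + t * b) * (a′ * s′ - d * (b′ * t′)) + b * b * (s′ * s′ - d * (t′ * t′))
    lem₁ = solve-∀
    lem₂ : ∀ d a b s t →
      t * t * (a * a - d * (b * b)) - (t * b + t * b) * (a * s - d * (b * t)) + b * b * (s * s - d * (t * t)) ≡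
      (a * t - s * b) * (a * t - s * b)
    lem₂ = solve-∀
    transport : ∀ u v w → u * A e′ - v * B e′ + w * C e′ ≡ u * A e - v * B e + w * C e
    transport u v w = cong₂ _+_ (cong₂ _-_ (cong (u *_) (sym A≡)) (cong (v *_) (sym B≡))) (cong (w *_) (sym C≡))
    pell : T * T - d * (U * U) ≡ 1ℤ
    pell = trans (lem₁ d a b s t a′ b′ s′ t′) (trans (transport (t * t) (t * b + t * b) (b * b))
      (trans (lem₂ d a b s t) (cong (λ x → x * x) (det e))))
    lem₃ : ∀ d a b s t a′ b′ s′ t′ →
      (t * a′ - b * s′) * (a * s′ - s * a′) - d * ((t * b′ - b * t′) * (a * t′ - s * b′)) ≡
      (- (s * t)) * (a′ * a′ - d * (b′ * b′)) - (- (a * t + s * b)) * (a′ * s′ - d * (b′ * t′)) + (- (a * b)) * (s′ * s′ - d * (t′ * t′))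
    lem₃ = solve-∀
    lem₄ : ∀ d a b s t →
      (- (s * t)) * (a * a - d * (b * b)) - (- (a * t + s * b)) * (a * s - d * (b * t)) + (- (a * b)) * (s * s - d * (t * t)) ≡ 0ℤ
    lem₄ = solve-∀
    orth : T * W - d * (U * Z) ≡ 0ℤ
    orth = trans (lem₃ d a b s t a′ b′ s′ t′) (trans (transport (- (s * t)) (- (a * t + s * b)) (- (a * b))) (lem₄ d a b s t))
    lem₅ : ∀ a b s t a′ b′ s′ t′ →
      (t * a′ - b * s′) * (a * t′ - s * b′) - (t * b′ - b * t′) * (a * s′ - s * a′) ≡ (a * t - s * b) * (a′ * t′ - s′ * b′)
    lem₅ = solve-∀
    unimod : T * Z - U * W ≡ 1ℤ
    unimod = trans (lem₅ a b s t a′ b′ s′ t′) (cong₂ _*_ (det e) (det e′))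
    U≢0 : U ≢ 0ℤ
    U≢0 U≡0 = ℕ.<-irrefl (cong₂ ℕ._+_ (cong₂ ℕ._+_ x₁≡ y₁≡) (cong₂ ℕ._+_ x₂≡ y₂≡)) size<
      where
      simp₁ : ∀ x w → x - 0ℤ * w ≡ x
      simp₁ = solve-∀
      simp₂ : ∀ x d z → x - d * (0ℤ * z) ≡ x
      simp₂ = solve-∀
      TZ : T * Z ≡ 1ℤ
      TZ = trans (sym (trans (cong (λ u → T * Z - u * W) U≡0) (simp₁ (T * Z) W))) unimod
      TW : T * W ≡ 0ℤ
      TW = trans (sym (trans (cong (λ u → T * W - d * (u * Z)) U≡0) (simp₂ (T * W) d Z))) orth
      W≡0 : W ≡ 0ℤ
      W≡0 = trans (sym (trans (cong (_* W) TZ) (*-identityˡ W))) (trans (lem T Z W) (trans (cong (Z *_) TW) (*-zeroʳ Z)))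
        where
        lem : ∀ T Z W → T * Z * W ≡ Z * (T * W)
        lem = solve-∀
      ∣TZ∣ : ∣ T ∣ ℕ.* ∣ Z ∣ ≡ 1
      ∣TZ∣ = trans (sym (abs-* T Z)) (cong ∣_∣ TZ)
      ∣T∣ : ∣ T ∣ ≡ 1
      ∣T∣ = ℕ.m*n≡1⇒m≡1 ∣ T ∣ ∣ Z ∣ ∣TZ∣
      ∣Z∣ : ∣ Z ∣ ≡ 1
      ∣Z∣ = ℕ.m*n≡1⇒n≡1 ∣ T ∣ ∣ Z ∣ ∣TZ∣
      scaled : ∀ n m k → + m ≡ + n * k → ∣ k ∣ ≡ 1 → n ≡ m
      scaled n m k eq ∣k∣ = sym (trans (cong ∣_∣ eq) (trans (abs-* (+ n) k) (trans (cong (n ℕ.*_) ∣k∣) (ℕ.*-identityʳ n))))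
      expand : ∀ v u w → (a * t - s * b) * v ≡ u + w → w ≡ 0ℤ → v ≡ u
      expand v u w eq w≡0 = trans (sym (*-identityˡ v)) (trans (cong (_* v) (sym (det e))) (trans eq (trans (cong (λ w → u + w) w≡0) (+-identityʳ u))))
      zeroˡ : ∀ v w → w ≡ 0ℤ → v * w ≡ 0ℤ
      zeroˡ v w eq = trans (cong (v *_) eq) (*-zeroʳ v)
      e₁ : ∀ a b s t a′ s′ → (a * t - s * b) * a′ ≡ a * (t * a′ - b * s′) + b * (a * s′ - s * a′)
      e₁ = solve-∀
      e₂ : ∀ a b s t b′ t′ → (a * t - s * b) * b′ ≡ b * (a * t′ - s * b′) + a * (t * b′ - b * t′)
      e₂ = solve-∀
      e₃ : ∀ a b s t a′ s′ → (a * t - s * b) * s′ ≡ s * (t * a′ - b * s′) + t * (a * s′ - s * a′)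
      e₃ = solve-∀
      e₄ : ∀ a b s t b′ t′ → (a * t - s * b) * t′ ≡ t * (a * t′ - s * b′) + s * (t * b′ - b * t′)
      e₄ = solve-∀
      x₁≡ : x₁ e ≡ x₁ e′
      x₁≡ = scaled (x₁ e) (x₁ e′) T (expand a′ (a * T) (b * W) (e₁ a b s t a′ s′) (zeroˡ b W W≡0)) ∣T∣
      y₁≡ : y₁ e ≡ y₁ e′
      y₁≡ = scaled (y₁ e) (y₁ e′) Z (expand b′ (b * Z) (a * U) (e₂ a b s t b′ t′) (zeroˡ a U U≡0)) ∣Z∣
      x₂≡ : x₂ e ≡ x₂ e′
      x₂≡ = scaled (x₂ e) (x₂ e′) T (expand s′ (s * T) (t * W) (e₃ a b s t a′ s′) (zeroˡ t W W≡0)) ∣T∣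
      y₂≡ : y₂ e ≡ y₂ e′
      y₂≡ = scaled (y₂ e) (y₂ e′) Z (expand t′ (t * Z) (s * U) (e₄ a b s t b′ t′) (zeroˡ s U U≡0)) ∣Z∣

sign-code : Sign → Fin 2
sign-code Sign.+ = Fin.zero
sign-code Sign.- = Fin.suc Fin.zero

sign-code-injective : ∀ s t → sign-code s ≡ sign-code t → s ≡ t
sign-code-injective Sign.+ Sign.+ _ = refl
sign-code-injective Sign.- Sign.- _ = refl

bounds : ∀ δ A B C → 0ℤ < A → C < 0ℤ → B * B + A * (- C) ≡ + δ →
  ∣ A ∣ ℕ.≤ δ × ∣ B ∣ ℕ.≤ δ × ∣ C ∣ ℕ.≤ δ
bounds δ (+ (suc a)) B -[1+ c ] _ _ eq = a≤ , b≤ ∣ B ∣ refl , c≤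
  where
  n = ∣ B ∣
  sq : ∀ B → B * B ≡ + (∣ B ∣ ℕ.* ∣ B ∣)
  sq (+ n) = sym (pos-* n n)
  sq -[1+ n ] = refl
  eqℕ : n ℕ.* n ℕ.+ suc a ℕ.* suc c ≡ δ
  eqℕ = +-injective (trans (cong₂ _+_ (sym (sq B)) (pos-* (suc a) (suc c))) eq)
  ac≤ : suc a ℕ.* suc c ℕ.≤ δ
  ac≤ = subst (suc a ℕ.* suc c ℕ.≤_) eqℕ (ℕ.m≤n+m _ (n ℕ.* n))
  a≤ : suc a ℕ.≤ δ
  a≤ = ℕ.≤-trans (ℕ.m≤m*n (suc a) (suc c)) ac≤
  c≤ : suc c ℕ.≤ δ
  c≤ = ℕ.≤-trans (ℕ.m≤n*m (suc c) (suc a)) ac≤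
  b≤ : ∀ k → k ≡ n → k ℕ.≤ δ
  b≤ zero _ = ℕ.z≤n
  b≤ (suc k) eqk = ℕ.≤-trans (ℕ.m≤m*n (suc k) (suc k)) (subst (suc k ℕ.* suc k ℕ.≤_) (trans (cong (λ k → k ℕ.* k ℕ.+ suc a ℕ.* suc c) eqk) eqℕ) (ℕ.m≤m+n _ _))
bounds δ (+ zero) B C (+<+ ()) _ _
bounds δ (+ suc a) B (+ c) _ (+<+ ()) _

module _ (δ : ℕ) (nonsq : NonSquare (+ δ)) where

  open Edge

  private
    M = suc δ

  size-bound : (e : Edge (+ δ)) → ∣ A e ∣ ℕ.≤ δ × ∣ B e ∣ ℕ.≤ δ × ∣ C e ∣ ℕ.≤ δ
  size-bound e = bounds δ (A e) (B e) (C e) (A>0 e) (C<0 e) (discriminant (+ δ) nonsq e)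

  codeA codeB codeC : Edge (+ δ) → Fin M
  codeA e = fromℕ< (ℕ.s≤s (proj₁ (size-bound e)))
  codeB e = fromℕ< (ℕ.s≤s (proj₁ (proj₂ (size-bound e))))
  codeC e = fromℕ< (ℕ.s≤s (proj₂ (proj₂ (size-bound e))))

  -- On the river the signs of A and C are known, so B alone needs a sign bit.
  code : Edge (+ δ) → Fin (2 ℕ.* (M ℕ.* (M ℕ.* M)))
  code e = combine (sign-code (sign (B e))) (combine (codeB e) (combine (codeA e) (codeC e)))

  pos-abs : ∀ {A} → 0ℤ < A → A ≡ + ∣ A ∣
  pos-abs {+ n} _ = refl

  neg-abs : ∀ {A} → A < 0ℤ → A ≡ - + ∣ A ∣
  neg-abs { -[1+ n ] } _ = refl
  neg-abs {+ n} (+<+ ())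

  code-injective : ∀ e e′ → code e ≡ code e′ → SameForm (+ δ) nonsq e e′
  code-injective e e′ eq = go (Fin.combine-injective _ _ _ _ eq)
    where
    go : _ → SameForm (+ δ) nonsq e e′
    go (s≡ , eq₂) =
      trans (pos-abs (A>0 e)) (trans (cong +_ A≡) (sym (pos-abs (A>0 e′)))) ,
      ◃-cong (sign-code-injective _ _ s≡) B≡ ,
      trans (neg-abs (C<0 e)) (trans (cong (λ t → - + t) C≡) (sym (neg-abs (C<0 e′))))
      where
      p = Fin.combine-injective (codeB e) (combine (codeA e) (codeC e)) (codeB e′) (combine (codeA e′) (codeC e′)) eq₂
      q = Fin.combine-injective (codeA e) (codeC e) (codeA e′) (codeC e′) (proj₂ p)
      A≡ : ∣ A e ∣ ≡ ∣ A e′ ∣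
      A≡ = Fin.fromℕ<-injective _ _ (ℕ.s≤s (proj₁ (size-bound e))) (ℕ.s≤s (proj₁ (size-bound e′))) (proj₁ q)
      B≡ : ∣ B e ∣ ≡ ∣ B e′ ∣
      B≡ = Fin.fromℕ<-injective _ _ (ℕ.s≤s (proj₁ (proj₂ (size-bound e)))) (ℕ.s≤s (proj₁ (proj₂ (size-bound e′)))) (proj₁ p)
      C≡ : ∣ C e ∣ ≡ ∣ C e′ ∣
      C≡ = Fin.fromℕ<-injective _ _ (ℕ.s≤s (proj₂ (proj₂ (size-bound e)))) (ℕ.s≤s (proj₂ (proj₂ (size-bound e′)))) (proj₂ q)

-- The river never ends but carries finitely many forms, so two of its edges carry the same one.
pell : ∀ δ → .{{ℕ.NonZero δ}} → NonSquare (+ δ) → ∃₂ λ T U → T * T - + δ * (U * U) ≡ 1ℤ × U ≢ 0ℤ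
pell δ@(suc k) nonsq = go (Fin.pigeonhole (ℕ.n<1+n _) (λ i → code δ nonsq (edge (toℕ i))))
  where
  start : Edge (+ δ)
  start = record { x₁ = 1 ; y₁ = 0 ; x₂ = 0 ; y₂ = 1 ; det = refl
    ; A>0 = subst (0ℤ <_) (sym (lem (+ δ))) (+<+ ℕ.z<s) ; C<0 = subst (_< 0ℤ) (sym (lem₂ (+ δ))) -<+ }
    where
    lem : ∀ d → 1ℤ * 1ℤ - d * (0ℤ * 0ℤ) ≡ 1ℤ
    lem = solve-∀
    lem₂ : ∀ d → 0ℤ * 0ℤ - d * (1ℤ * 1ℤ) ≡ - d
    lem₂ = solve-∀
  edge : ℕ → Edge (+ δ)
  edge = iter (+ δ) nonsq start
  go : _ → _
  go (i , j , i<j , eq) = same-form-solution (+ δ) nonsq (edge (toℕ i)) (edge (toℕ j))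
    (code-injective δ nonsq (edge (toℕ i)) (edge (toℕ j)) eq) (iter-mono (+ δ) nonsq start i<j)

-- Split primes

∣-lin₃ : ∀ {k a b c n} u v w → k ∣ a → k ∣ b → k ∣ c → n ≡ u * a + v * b + w * c → k ∣ n
∣-lin₃ {k} {a} {b} {c} u v w p q r eq = subst (k ∣_) (sym eq) (∣m∣n⇒∣m+n (∣-lin u v p q refl) (∣-mul w r refl))

-- The reduced norm of α + βj in the quaternion algebra with i² = −1, j² = D.
Q : ℤ → G → G → ℤ
Q D α β = N α - D * N β

-- From jz = z̄j: (α + βj)(α′ + β′j) = (αα′ + Dββ̄′) + (αβ′ + βᾱ′)j.
qmul : ℤ → G × G → G × G → G × G
qmul D ((a , b) , (c , d)) ((e , f) , (g , h)) =
  (a * e - b * f + D * (c * g + d * h) , a * f + b * e + D * (d * g - c * h)) ,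
  (a * g - b * h + (c * e + d * f) , a * h + b * g + (d * e - c * f))

Q-mul : ∀ D x y → Q D (proj₁ (qmul D x y)) (proj₂ (qmul D x y)) ≡ Q D (proj₁ x) (proj₂ x) * Q D (proj₁ y) (proj₂ y)
Q-mul D ((a , b) , (c , d)) ((e , f) , (g , h)) = lem D a b c d e f g h
  where
  lem : ∀ D a b c d e f g h →
    ((a * e - b * f + D * (c * g + d * h)) * (a * e - b * f + D * (c * g + d * h)) +
     (a * f + b * e + D * (d * g - c * h)) * (a * f + b * e + D * (d * g - c * h)))
    - D * ((a * g - b * h + (c * e + d * f)) * (a * g - b * h + (c * e + d * f)) +
           (a * h + b * g + (d * e - c * f)) * (a * h + b * g + (d * e - c * f)))
    ≡ (a * a + b * b - D * (c * c + d * d)) * (e * e + f * f - D * (g * g + h * h))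
  lem = solve-∀

Represents : ℤ → ℤ → Set
Represents D n = ∃₂ λ α β → Q D α β ≡ n

Represents-mul : ∀ {D m n} → Represents D m → Represents D n → Represents D (m * n)
Represents-mul {D} (α , β , eq) (α′ , β′ , eq′) =
  proj₁ (qmul D (α , β) (α′ , β′)) , proj₂ (qmul D (α , β) (α′ , β′)) ,
  trans (Q-mul D (α , β) (α′ , β′)) (cong₂ _*_ eq eq′)

Represents-norm : ∀ {D} z → Represents D (N z)
Represents-norm {D} z = z , (0ℤ , 0ℤ) , lem D (N z)
  where
  lem : ∀ D n → n - D * (0ℤ * 0ℤ + 0ℤ * 0ℤ) ≡ n
  lem = solve-∀

-- If r² ≡ -1 modulo ℓ, this is the reduction of ℤ[i] modulo one prime above ℓ, with i ↦ r;
-- `φ (- r)` belongs to the conjugate prime. The identities below keep r² + 1 as an explicit error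
-- term and so hold in ℤ.
φ : ℤ → G → ℤ
φ r (x , y) = x + r * y

φ-⊗ : ∀ r z w → φ r (z ⊗ w) ≡ φ r z * φ r w + - (proj₂ z * proj₂ w) * (r * r + 1ℤ)
φ-⊗ r (a , b) (c , d) = lem r a b c d
  where
  lem : ∀ r a b c d → a * c - b * d + r * (a * d + b * c) ≡ (a + r * b) * (c + r * d) + - (b * d) * (r * r + 1ℤ)
  lem = solve-∀

N-φ : ∀ r z → N z ≡ φ (- r) z * φ r z + proj₂ z * proj₂ z * (r * r + 1ℤ)
N-φ r (x , y) = lem r x y
  where
  lem : ∀ r x y → x * x + y * y ≡ (x + - r * y) * (x + r * y) + y * y * (r * r + 1ℤ)
  lem = solve-∀

φ-conj : ∀ r z → φ r (conj z) ≡ φ (- r) z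
φ-conj r (x , y) = lem r x y
  where
  lem : ∀ r x y → x + r * - y ≡ x + - r * y
  lem = solve-∀

φ-conj⁻ : ∀ r z → φ (- r) (conj z) ≡ φ r z
φ-conj⁻ r (x , y) = lem r x y
  where
  lem : ∀ r x y → x + - r * - y ≡ x + r * y
  lem = solve-∀

root-neg : ∀ r → - r * - r + 1ℤ ≡ r * r + 1ℤ
root-neg = solve-∀

∤-* : ∀ {p} → Prime p → ∀ {a b} → ¬ + p ∣ a → ¬ + p ∣ b → ¬ + p ∣ a * b
∤-* pr {a} {b} p∤a p∤b h with euclid pr a b h
... | inj₁ g = p∤a g
... | inj₂ g = p∤b g

module _ {ℓ : ℕ} (pr : Prime ℓ) where

  φ∤-⊗ : ∀ r → + ℓ ∣ r * r + 1ℤ → ∀ z w → ¬ + ℓ ∣ φ r z → ¬ + ℓ ∣ φ r w → ¬ + ℓ ∣ φ r (z ⊗ w)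
  φ∤-⊗ r ℓ∣ z w ∤z ∤w h = ∤-* pr ∤z ∤w
    (∣-lin 1ℤ (proj₂ z * proj₂ w) h ℓ∣ (trans (lem (φ r z * φ r w) (proj₂ z * proj₂ w) (r * r + 1ℤ))
      (cong (λ t → 1ℤ * t + proj₂ z * proj₂ w * (r * r + 1ℤ)) (sym (φ-⊗ r z w)))))
    where
    lem : ∀ a b c → a ≡ 1ℤ * (a + - b * c) + b * c
    lem = solve-∀

  φ∣-⊗ : ∀ r → + ℓ ∣ r * r + 1ℤ → ∀ z w → + ℓ ∣ φ r z → + ℓ ∣ φ r (z ⊗ w)
  φ∣-⊗ r ℓ∣ z w h = ∣-lin (φ r w) (- (proj₂ z * proj₂ w)) h ℓ∣
    (trans (φ-⊗ r z w) (cong (_+ - (proj₂ z * proj₂ w) * (r * r + 1ℤ)) (*-comm (φ r z) (φ r w))))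

  φ∣⇒∣N : ∀ r → + ℓ ∣ r * r + 1ℤ → ∀ z → + ℓ ∣ φ r z → + ℓ ∣ N z
  φ∣⇒∣N r ℓ∣ z h = ∣-lin (φ (- r) z) (proj₂ z * proj₂ z) h ℓ∣ (N-φ r z)

  prime-above : ∀ r → + ℓ ∣ r * r + 1ℤ → ∃ λ π → + ℓ ≡ N π × + ℓ ∣ φ r π
  prime-above r ℓ∣ = go (split⇒norm {{prime⇒nonZero pr}} (r , ℓ∣))
    where
    go : (∃ λ z → + ℓ ≡ N z) → ∃ λ π → + ℓ ≡ N π × + ℓ ∣ φ r π
    go (z , eq) = go′ (euclid pr (φ (- r) z) (φ r z)
        (∣-lin 1ℤ (- (proj₂ z * proj₂ z)) (∣-reflexive eq) ℓ∣
          (trans (lem (φ (- r) z * φ r z) (proj₂ z * proj₂ z) (r * r + 1ℤ)) (cong (λ t → 1ℤ * t + - (proj₂ z * proj₂ z) * (r * r + 1ℤ)) (sym (N-φ r z))))))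
      where
      lem : ∀ a b c → a ≡ 1ℤ * (a + b * c) + - b * c
      lem = solve-∀
      go′ : (+ ℓ ∣ φ (- r) z) ⊎ (+ ℓ ∣ φ r z) → ∃ λ π → + ℓ ≡ N π × + ℓ ∣ φ r π
      go′ (inj₁ h) = conj z , trans eq (sym (N-conj z)) , subst (+ ℓ ∣_) (sym (φ-conj r z)) h
      go′ (inj₂ h) = z , eq , h

  norm-coprime : ∀ c d → + ℓ ≡ N (c , d) → ¬ + ℓ ∣ c
  norm-coprime c d eq ℓ∣c@(divides u c≡) = go (euclid-square pr d (∣-lin 1ℤ (- c) (∣-reflexive eq) ℓ∣c (lem c d)))
    where
    lem : ∀ c d → d * d ≡ 1ℤ * (c * c + d * d) + - c * c
    lem = solve-∀
    lem₂ : ∀ u v l → u * l * (u * l) + v * l * (v * l) ≡ l * ((u * u + v * v) * l)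
    lem₂ = solve-∀
    go : ¬ + ℓ ∣ d
    go (divides v d≡) = prime∤1 pr (divides (u * u + v * v) (cancelˡ (+ ℓ) (prime≢0 pr)
      (trans (*-identityʳ (+ ℓ)) (trans eq (trans (cong₂ (λ c d → c * c + d * d) c≡ d≡) (lem₂ u v (+ ℓ)))))))

  -- The values of `φ r` at π and π̄ add up to 2c, and ℓ divides neither factor. This is where an
  -- odd ℓ separates π from π̄.
  conj-prime : ∀ r → ¬ + ℓ ∣ + 2 → ∀ π → + ℓ ≡ N π → + ℓ ∣ φ r π → ¬ + ℓ ∣ φ r (conj π)
  conj-prime r ℓ∤2 (c , d) eq h h′ = ∤-* pr ℓ∤2 (norm-coprime c d eq) (∣-lin 1ℤ 1ℤ h h′ (lem r c d))
    where
    lem : ∀ r c d → + 2 * c ≡ 1ℤ * (c + r * d) + 1ℤ * (c + r * - d)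
    lem = solve-∀

module SplitPrime {ℓ : ℕ} (pr : Prime ℓ) (ℓ∤2 : ¬ + ℓ ∣ + 2) (r : ℤ) (ℓ∣ : + ℓ ∣ r * r + 1ℤ)
  (π : G) (Nπ : + ℓ ≡ N π) (φπ : + ℓ ∣ φ r π) where

  private
    ℓ∣⁻ : + ℓ ∣ - r * - r + 1ℤ
    ℓ∣⁻ = subst (+ ℓ ∣_) (sym (root-neg r)) ℓ∣

  π̄² : G
  π̄² = conj π ⊗ conj π

  N-π̄² : N π̄² ≡ + ℓ * + ℓ
  N-π̄² = trans (N-⊗ (conj π) (conj π)) (cong (λ t → t * t) (trans (N-conj π) (sym Nπ)))

  φ-π̄² : ¬ + ℓ ∣ φ r π̄²
  φ-π̄² = φ∤-⊗ pr r ℓ∣ (conj π) (conj π) c c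
    where c = conj-prime pr r ℓ∤2 π Nπ φπ

  φ⁻-π̄² : + ℓ ∣ φ (- r) π̄²
  φ⁻-π̄² = φ∣-⊗ pr (- r) ℓ∣⁻ (conj π) (conj π) (subst (+ ℓ ∣_) (sym (φ-conj⁻ r π)) φπ)

  -- Replacing each factor ℓ of U by π̄² keeps the norm and makes the result prime to π.
  tilt : ∀ U → U ≢ 0ℤ → ∃ λ δ → N δ ≡ U * U × ¬ + ℓ ∣ φ r δ
  tilt U U≢0 = <-rec P step ∣ U ∣ U refl U≢0
    where
    P : ℕ → Set
    P n = ∀ U → n ≡ ∣ U ∣ → U ≢ 0ℤ → ∃ λ δ → N δ ≡ U * U × ¬ + ℓ ∣ φ r δ
    lem₁ : ∀ U → U * U + 0ℤ * 0ℤ ≡ U * U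
    lem₁ = solve-∀
    lem₂ : ∀ r U → U + r * 0ℤ ≡ U
    lem₂ = solve-∀
    lem₃ : ∀ l V → l * l * (V * V) ≡ V * l * (V * l)
    lem₃ = solve-∀
    step : ∀ n → (∀ {m} → m ℕ.< n → P m) → P n
    step n rec U n≡ U≢0 = go (+ ℓ ∣? U)
      where
      go : Dec (+ ℓ ∣ U) → ∃ λ δ → N δ ≡ U * U × ¬ + ℓ ∣ φ r δ
      go (no h) = (U , 0ℤ) , lem₁ U , λ g → h (subst (+ ℓ ∣_) (lem₂ r U) g)
      go (yes (divides V U≡)) = go′ (rec smaller V refl V≢0)
        where
        V≢0 : V ≢ 0ℤ
        V≢0 V≡0 = U≢0 (trans U≡ (cong (_* + ℓ) V≡0))
        smaller : ∣ V ∣ ℕ.< n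
        smaller = subst (∣ V ∣ ℕ.<_) (sym (trans n≡ (trans (cong ∣_∣ U≡) (abs-* V (+ ℓ)))))
          (ℕ.m<m*n ∣ V ∣ ℓ {{≢-nonZero V≢0}} (ℕ.nonTrivial⇒n>1 ℓ {{prime⇒nonTrivial pr}}))
        go′ : (∃ λ δ → N δ ≡ V * V × ¬ + ℓ ∣ φ r δ) → ∃ λ δ → N δ ≡ U * U × ¬ + ℓ ∣ φ r δ
        go′ (δ , Nδ , φδ) = π̄² ⊗ δ ,
          trans (N-⊗ π̄² δ) (trans (cong₂ _*_ N-π̄² Nδ) (trans (lem₃ (+ ℓ) V) (sym (cong (λ t → t * t) U≡)))) ,
          φ∤-⊗ pr r ℓ∣ π̄² δ φ-π̄² φδ

  -- Modulo ℓ, sending α + βj to the matrix with rows (φ r α, φ r β) and (D φ(-r) β, φ(-r) α) is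
  -- multiplicative. The fields say that T + δj has norm one and becomes upper triangular unipotent
  -- with corner entry φ r δ ≠ 0.
  record Unipotent (D : ℤ) : Set where
    field
      T : ℤ
      δ : G
      norm-one : T * T - D * N δ ≡ 1ℤ
      T≡1 : + ℓ ∣ T - 1ℤ
      φδ : ¬ + ℓ ∣ φ r δ
      φ⁻δ : + ℓ ∣ φ (- r) δ

  -- Let t² - Dℓ²u² = 1. Then t ≡ ±1 modulo ℓ, and passing to the square of this solution gives T =
  -- t² + Dℓ²u² ≡ 1 with T² - Dℓ²(2tu)² = 1. It remains to write ℓ²(2tu)² as a norm with the right
  -- reductions.
  unipotent : ∀ D → .{{ℕ.NonZero D}} → NonSquare (+ D) → Unipotent (+ D)
  unipotent D {{D≢0}} nonsq = go (pell (D ℕ.* (ℓ ℕ.* ℓ)) {{ℕ.m*n≢0 D (ℓ ℕ.* ℓ) {{D≢0}} {{ℓ²≢0}}}} nonsq′)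
    where
    ℓ≢0 : ℕ.NonZero ℓ
    ℓ≢0 = prime⇒nonZero pr
    ℓ²≢0 : ℕ.NonZero (ℓ ℕ.* ℓ)
    ℓ²≢0 = ℕ.m*n≢0 ℓ ℓ {{ℓ≢0}} {{ℓ≢0}}
    cast : + (D ℕ.* (ℓ ℕ.* ℓ)) ≡ + D * (+ ℓ * + ℓ)
    cast = trans (pos-* D (ℓ ℕ.* ℓ)) (cong (+ D *_) (pos-* ℓ ℓ))
    nonsq′ : NonSquare (+ (D ℕ.* (ℓ ℕ.* ℓ)))
    nonsq′ x y eq = cancelˡ (+ ℓ) (prime≢0 pr) (trans (nonsq x (+ ℓ * y) (trans eq (trans (cong (_* (y * y)) cast) (lem (+ D) (+ ℓ) y)))) (sym (*-zeroʳ (+ ℓ))))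
      where
      lem : ∀ D l y → D * (l * l) * (y * y) ≡ D * (l * y * (l * y))
      lem = solve-∀
    go : (∃₂ λ T U → T * T - + (D ℕ.* (ℓ ℕ.* ℓ)) * (U * U) ≡ 1ℤ × U ≢ 0ℤ) → Unipotent (+ D)
    go (t , u , eq₀ , u≢0) = go′ (tilt V V≢0)
      where
      V = + 2 * (t * u)
      eq : t * t - + D * (+ ℓ * + ℓ) * (u * u) ≡ 1ℤ
      eq = trans (cong (λ k → t * t - k * (u * u)) (sym cast)) eq₀
      t≢0 : t ≢ 0ℤ
      t≢0 t≡0 = prime∤1 pr (divides (- (+ D * + ℓ * (u * u)))
        (trans (sym eq) (trans (cong (λ t → t * t - + D * (+ ℓ * + ℓ) * (u * u)) t≡0) (lem (+ D) (+ ℓ) u))))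
        where
        lem : ∀ D l u → 0ℤ * 0ℤ - D * (l * l) * (u * u) ≡ - (D * l * (u * u)) * l
        lem = solve-∀
      V≢0 : V ≢ 0ℤ
      V≢0 V≡0 with i*j≡0⇒i≡0∨j≡0 t (cancelˡ (+ 2) {b = 0ℤ} (λ ()) V≡0)
      ... | inj₁ h = t≢0 h
      ... | inj₂ h = u≢0 h
      go′ : (∃ λ δ → N δ ≡ V * V × ¬ + ℓ ∣ φ r δ) → Unipotent (+ D)
      go′ (δ , Nδ , φδ) = record
        { T = t * t + + D * (+ ℓ * + ℓ) * (u * u)
        -- The further π̄² contributes ℓ² to the norm and makes the reduction at the conjugate prime
        -- vanish.
        ; δ = π̄² ⊗ δ
        ; norm-one = trans (cong (λ k → (t * t + + D * (+ ℓ * + ℓ) * (u * u)) * (t * t + + D * (+ ℓ * + ℓ) * (u * u)) - + D * k)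
            (trans (N-⊗ π̄² δ) (cong₂ _*_ N-π̄² Nδ))) (trans (lem₁ (+ D) (+ ℓ) t u) (cong (λ k → k * k) eq))
        ; T≡1 = divides (+ 2 * + D * + ℓ * (u * u)) (trans (cong (λ k → t * t + + D * (+ ℓ * + ℓ) * (u * u) - k) (sym eq)) (lem₂ (+ D) (+ ℓ) t u))
        ; φδ = φ∤-⊗ pr r ℓ∣ π̄² δ φ-π̄² φδ
        ; φ⁻δ = φ∣-⊗ pr (- r) ℓ∣⁻ π̄² δ φ⁻-π̄²
        }
        where
        lem₁ : ∀ D l t u → (t * t + D * (l * l) * (u * u)) * (t * t + D * (l * l) * (u * u)) - D * (l * l * (+ 2 * (t * u) * (+ 2 * (t * u)))) ≡
          (t * t - D * (l * l) * (u * u)) * (t * t - D * (l * l) * (u * u))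
        lem₁ = solve-∀
        lem₂ : ∀ D l t u → t * t + D * (l * l) * (u * u) - (t * t - D * (l * l) * (u * u)) ≡ + 2 * D * l * (u * u) * l
        lem₂ = solve-∀

  act-norm : ∀ D T δ → T * T - D * N δ ≡ 1ℤ → ∀ g → Q D (proj₁ (qmul D g ((T , 0ℤ) , δ))) (proj₂ (qmul D g ((T , 0ℤ) , δ))) ≡ Q D (proj₁ g) (proj₂ g)
  act-norm D T δ one g = trans (Q-mul D g ((T , 0ℤ) , δ)) (trans (cong (Q D (proj₁ g) (proj₂ g) *_)
    (trans (lem T (D * N δ)) one)) (*-identityʳ (Q D (proj₁ g) (proj₂ g))))
    where
    lem : ∀ T x → T * T + 0ℤ * 0ℤ - x ≡ T * T - x
    lem = solve-∀

  -- First entry of the first row after right multiplication by T + δj. For the unipotent every term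
  -- but the leading one is divisible by ℓ; with δ̄ in place of δ the term with φ(-r) δ̄ = φ r δ
  -- survives.
  act-φα : ∀ D T δ g → φ r (proj₁ (qmul D g ((T , 0ℤ) , δ))) ≡
    φ r (proj₁ g) + φ r (proj₁ g) * (T - 1ℤ) + D * φ r (proj₂ g) * φ (- r) δ + D * (proj₂ (proj₂ g) * proj₂ δ) * (r * r + 1ℤ)
  act-φα D T (x , y) ((a , b) , (c , d)) = lem r D T x y a b c d
    where
    lem : ∀ r D T x y a b c d → a * T - b * 0ℤ + D * (c * x + d * y) + r * (a * 0ℤ + b * T + D * (d * x - c * y)) ≡
      (a + r * b) + (a + r * b) * (T - 1ℤ) + D * (c + r * d) * (x + - r * y) + D * (d * y) * (r * r + 1ℤ)
    lem = solve-∀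

  act-φβ : ∀ D T δ g → φ r (proj₂ (qmul D g ((T , 0ℤ) , δ))) ≡
    φ r (proj₂ g) + φ r (proj₁ g) * φ r δ + φ r (proj₂ g) * (T - 1ℤ) + - (proj₂ (proj₁ g) * proj₂ δ) * (r * r + 1ℤ)
  act-φβ D T (x , y) ((a , b) , (c , d)) = lem r D T x y a b c d
    where
    lem : ∀ r D T x y a b c d → a * x - b * y + (c * T + d * 0ℤ) + r * (a * y + b * x + (d * T - c * 0ℤ)) ≡
      (c + r * d) + (a + r * b) * (x + r * y) + (c + r * d) * (T - 1ℤ) + - (b * y) * (r * r + 1ℤ)
    lem = solve-∀

  module _ (D : ℤ) (unip : Unipotent D) where
    open Unipotent unip

    -- First row modulo ℓ after n multiplications by the unipotent: α is fixed and β moves along an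
    -- arithmetic progression.
    Orbit : G × G → ℕ → Set
    Orbit g n = ∃ λ h → Q D (proj₁ h) (proj₂ h) ≡ Q D (proj₁ g) (proj₂ g) ×
      (+ ℓ ∣ φ r (proj₁ h) - φ r (proj₁ g)) × (+ ℓ ∣ φ r (proj₂ h) - (φ r (proj₂ g) + + n * (φ r (proj₁ g) * φ r δ)))

    Reduced : G × G → Set
    Reduced g = ∃ λ h → Q D (proj₁ h) (proj₂ h) ≡ Q D (proj₁ g) (proj₂ g) × + ℓ ∣ N (proj₂ h)

    orbit : ∀ g n → Orbit g n
    orbit g zero = g , refl , divides 0ℤ (lem₁ (φ r (proj₁ g))) , divides 0ℤ (lem₂ (φ r (proj₂ g)) (φ r (proj₁ g) * φ r δ))
      where
      lem₁ : ∀ a → a - a ≡ 0ℤ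
      lem₁ = solve-∀
      lem₂ : ∀ b s → b - (b + 0ℤ * s) ≡ 0ℤ
      lem₂ = solve-∀
    orbit g (suc n) = go (orbit g n)
      where
      go : Orbit g n → Orbit g (suc n)
      go (h , eq , ha , hb) = qmul D h ((T , 0ℤ) , δ) , trans (act-norm D T δ norm-one h) eq ,
        ∣-lin 1ℤ 1ℤ sa ha (lemA (φ r (proj₁ h′)) (φ r (proj₁ h)) (φ r (proj₁ g))) ,
        ∣-lin₃ 1ℤ 1ℤ (φ r δ) sb hb ha (lemB (φ r (proj₂ h′)) (φ r (proj₂ h)) (φ r (proj₁ h)) (φ r (proj₂ g)) (φ r (proj₁ g)) (φ r δ) (+ n))
        where
        h′ = qmul D h ((T , 0ℤ) , δ)
        lemA : ∀ x y z → x - z ≡ 1ℤ * (x - y) + 1ℤ * (y - z)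
        lemA = solve-∀
        lemB : ∀ b′ b a b₀ a₀ e n → b′ - (b₀ + (1ℤ + n) * (a₀ * e)) ≡
          1ℤ * (b′ - (b + a * e)) + 1ℤ * (b - (b₀ + n * (a₀ * e))) + e * (a - a₀)
        lemB = solve-∀
        sa : + ℓ ∣ φ r (proj₁ h′) - φ r (proj₁ h)
        sa = ∣-lin₃ (φ r (proj₁ h)) (D * φ r (proj₂ h)) (D * (proj₂ (proj₂ h) * proj₂ δ)) T≡1 φ⁻δ ℓ∣
          (trans (cong (_- φ r (proj₁ h)) (act-φα D T δ h)) (lem (φ r (proj₁ h)) (φ r (proj₁ h) * (T - 1ℤ)) _ _))
          where
          lem : ∀ x a b c → x + a + b + c - x ≡ a + b + c
          lem = solve-∀
        sb : + ℓ ∣ φ r (proj₂ h′) - (φ r (proj₂ h) + φ r (proj₁ h) * φ r δ)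
        sb = ∣-lin (φ r (proj₂ h)) (- (proj₂ (proj₁ h) * proj₂ δ)) T≡1 ℓ∣
          (trans (cong (_- (φ r (proj₂ h) + φ r (proj₁ h) * φ r δ)) (act-φβ D T δ h)) (lem (φ r (proj₂ h)) (φ r (proj₁ h) * φ r δ) _ _))
          where
          lem : ∀ x y b c → x + y + b + c - (x + y) ≡ b + c
          lem = solve-∀

    -- The step φ r α · φ r δ of the progression is invertible modulo ℓ, so the progression meets 0.
    kill-β : ∀ g → ¬ + ℓ ∣ φ r (proj₁ g) → Reduced g
    kill-β g ∤α = go (inverse pr s (∤-* pr ∤α φδ))
      where
      s = φ r (proj₁ g) * φ r δ
      t = φ r (proj₂ g)
      instance
        _ = prime⇒nonZero pr
      go : (∃ λ b → + ℓ ∣ s * b - 1ℤ) → Reduced g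
      go (b , inv) = go′ (orbit g n)
        where
        m = - (t * b)
        -- Reduced to a natural number, since it counts multiplications.
        n = m %ℕ ℓ
        q = m /ℕ ℓ
        m≡ : m ≡ + n + q * + ℓ
        m≡ = a≡a%ℕn+[a/ℕn]*n m ℓ
        root : + ℓ ∣ t + + n * s
        root = ∣-lin (- t) (- (q * s)) inv (∣-refl {+ ℓ})
          (trans (lem₁ t s q (+ n) (+ ℓ)) (trans (cong (λ k → t + k * s + - (q * s) * + ℓ) (sym m≡)) (lem₂ t s b (- (q * s) * + ℓ))))
          where
          lem₁ : ∀ t s q n l → t + n * s ≡ t + (n + q * l) * s + - (q * s) * l
          lem₁ = solve-∀
          lem₂ : ∀ t s b y → t + - (t * b) * s + y ≡ - t * (s * b - 1ℤ) + y
          lem₂ = solve-∀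
        go′ : Orbit g n → Reduced g
        go′ (h , eq , _ , hb) = h , eq , φ∣⇒∣N pr r ℓ∣ (proj₂ h) (∣-lin 1ℤ 1ℤ hb root (lem (φ r (proj₂ h)) (t + + n * s)))
          where
          lem : ∀ x y → x ≡ 1ℤ * (x - y) + 1ℤ * y
          lem = solve-∀

    -- If φ r α vanishes and φ r β does not, one multiplication by T + δ̄j, which is lower
    -- triangular modulo ℓ, first adds D φ r β · φ r δ to φ r α. For this ℓ must not divide D.
    make-ℓ∣Nβ : ¬ + ℓ ∣ D → ∀ g → Reduced g
    make-ℓ∣Nβ ℓ∤D g = go (+ ℓ ∣? φ r (proj₁ g)) (+ ℓ ∣? φ r (proj₂ g))
      where
      go : Dec (+ ℓ ∣ φ r (proj₁ g)) → Dec (+ ℓ ∣ φ r (proj₂ g)) → Reduced g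
      go (no ∤α) _ = kill-β g ∤α
      go (yes _) (yes ∣β) = g , refl , φ∣⇒∣N pr r ℓ∣ (proj₂ g) ∣β
      go (yes ∣α) (no ∤β) = go′ (kill-β g′ ∤α′)
        where
        g′ = qmul D g ((T , 0ℤ) , conj δ)
        one : T * T - D * N (conj δ) ≡ 1ℤ
        one = trans (cong (λ k → T * T - D * k) (N-conj δ)) norm-one
        go′ : Reduced g′ → Reduced g
        go′ (h , eq , d) = h , trans eq (act-norm D T (conj δ) one g) , d
        ∤α′ : ¬ + ℓ ∣ φ r (proj₁ g′)
        ∤α′ d = ∤-* pr (∤-* pr ℓ∤D ∤β) φδ
          (∣-lin₃ 1ℤ (- T) (- Y) d ∣α ℓ∣
            (trans (cong (D * φ r (proj₂ g) *_) (sym (φ-conj⁻ r δ)))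
              (trans (lem (φ r (proj₁ g)) T (D * φ r (proj₂ g) * φ (- r) (conj δ)) Y (r * r + 1ℤ))
                (cong (λ k → 1ℤ * k + - T * φ r (proj₁ g) + - Y * (r * r + 1ℤ)) (sym (act-φα D T (conj δ) g))))))
          where
          Y = D * (proj₂ (proj₂ g) * proj₂ (conj δ))
          lem : ∀ a T x y z → x ≡ 1ℤ * (a + a * (T - 1ℤ) + x + y * z) + - T * a + - y * z
          lem = solve-∀

-- Once ℓ ∣ N(β), also N(β) = ℓ N(w), and the factor ℓ can be counted with D.
absorb : ∀ {ℓ} → Prime ℓ → ¬ + ℓ ∣ + 2 → Split ℓ → ∀ D → .{{ℕ.NonZero D}} → NonSquare (+ D) → ¬ + ℓ ∣ + D →
  ∀ {n} → Represents (+ D) n → Represents (+ D * + ℓ) n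
absorb {ℓ} pr ℓ∤2 (r , ℓ∣) D nonsq ℓ∤D {n} (α , β , eq) = go (prime-above pr r ℓ∣)
  where
  go : (∃ λ π → + ℓ ≡ N π × + ℓ ∣ φ r π) → Represents (+ D * + ℓ) n
  go (π , Nπ , φπ) = go′ (make-ℓ∣Nβ (+ D) unip ℓ∤D (α , β))
    where
    open SplitPrime pr ℓ∤2 r ℓ∣ π Nπ φπ
    unip = unipotent D nonsq
    go′ : Reduced (+ D) unip (α , β) → Represents (+ D * + ℓ) n
    go′ ((α′ , β′) , eq′ , d) = go″ (split-norm pr π β′ Nπ d)
      where
      go″ : (∃ λ w → N β′ ≡ + ℓ * N w) → Represents (+ D * + ℓ) n
      go″ (w , Nw) = α′ , w , trans (cong (λ k → N α′ - k) (trans (*-assoc (+ D) (+ ℓ) (N w)) (cong (+ D *_) (sym Nw)))) (trans eq′ eq)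

-- After ℓ has been absorbed, N(α) = ℓn + Dℓ N(β) is divisible by ℓ; dividing by ℓ, with N(α) = ℓ
-- N(w), gives back the form for D.
cancel-split : ∀ {ℓ} → Prime ℓ → ¬ + ℓ ∣ + 2 → Split ℓ → ∀ D → .{{ℕ.NonZero D}} → NonSquare (+ D) → ¬ + ℓ ∣ + D →
  ∀ {n} → Represents (+ D) (+ ℓ * n) → Represents (+ D) n
cancel-split {ℓ} pr ℓ∤2 sp D nonsq ℓ∤D {n} s =
  go (absorb pr ℓ∤2 sp D nonsq ℓ∤D s) (split⇒norm {{prime⇒nonZero pr}} sp)
  where
  go : Represents (+ D * + ℓ) (+ ℓ * n) → (∃ λ π → + ℓ ≡ N π) → Represents (+ D) n
  go (α , β , eq) (π , Nπ) = go′ (split-norm pr π α Nπ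
      (∣-lin n (+ D * N β) (∣-refl {+ ℓ}) (∣-refl {+ ℓ}) (trans (lem₁ (N α) (+ D) (+ ℓ) (N β)) (trans (cong (_+ + D * N β * + ℓ) eq) (cong (_+ + D * N β * + ℓ) (*-comm (+ ℓ) n))))))
    where
    lem₁ : ∀ a D l b → a ≡ (a - D * l * b) + D * b * l
    lem₁ = solve-∀
    go′ : (∃ λ w → N α ≡ + ℓ * N w) → Represents (+ D) n
    go′ (w , Nw) = w , β , cancelˡ (+ ℓ) (prime≢0 pr) (trans (lem₂ (N w) (+ D) (+ ℓ) (N β)) (trans (cong (λ k → k - + D * + ℓ * N β) (sym Nw)) eq))
      where
      lem₂ : ∀ w D l b → l * (w - D * b) ≡ l * w - D * l * b
      lem₂ = solve-∀

-- Division of values by norms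

prime-ind : (P : ℕ → Set) → P 1 → (∀ p n → Prime p → P n → P (p ℕ.* n)) → ∀ n → .{{ℕ.NonZero n}} → P n
prime-ind P base step n = subst P (sym isFactorisation) (go factors factorsPrime)
  where
  open PrimeFactorisation (factorise n)
  go : ∀ ps → All Prime ps → P (product ps)
  go [] [] = base
  go (p ∷ ps) (pr ∷ prs) = step p (product ps) pr (go ps prs)

prime-divisor : ∀ n → .{{ℕ.NonZero n}} → n ≡ 1 ⊎ (∃ λ p → Prime p × p ℕᵈ.∣ n)
prime-divisor = prime-ind _ (inj₁ refl) (λ p n pr _ → inj₂ (p , pr , ℕᵈ.m∣m*n n))

prime∣prime : ∀ {p q} → Prime p → Prime q → + p ∣ + q → p ≡ q
prime∣prime pr qr d with prime⇒irreducible qr (∣⇒∣ᵤ d)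
... | inj₁ refl = contradiction pr ¬prime[1]
... | inj₂ eq = eq

∣2⇒≡2 : ∀ {p} → Prime p → + p ∣ + 2 → p ≡ 2
∣2⇒≡2 pr = prime∣prime pr prime[2]

split-2 : Split 2
split-2 = 1ℤ , divides 1ℤ refl

nonsplit⇒∤2 : ∀ {p} → Prime p → ¬ Split p → ¬ + p ∣ + 2
nonsplit⇒∤2 pr ns d = ns (subst Split (sym (∣2⇒≡2 pr d)) split-2)

N≡+∣N∣ : ∀ z → N z ≡ + ∣ N z ∣
N≡+∣N∣ z = sym (0≤i⇒+∣i∣≡i (N≥0 z))

Represents-cast : ∀ D {m n} → m ≡ n → Represents D m → Represents D n
Represents-cast D = subst (Represents D)

parity : ∀ n → (∃ λ k → n ≡ + 2 * k) ⊎ (∃ λ k → n ≡ 1ℤ + + 2 * k)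
parity n = go (n %ℕ 2) (n%ℕd<d n 2) (a≡a%ℕn+[a/ℕn]*n n 2)
  where
  go : ∀ s → s ℕ.< 2 → n ≡ + s + (n /ℕ 2) * + 2 → (∃ λ k → n ≡ + 2 * k) ⊎ (∃ λ k → n ≡ 1ℤ + + 2 * k)
  go zero _ eq = inj₁ (n /ℕ 2 , trans eq (trans (+-identityˡ (n /ℕ 2 * + 2)) (*-comm (n /ℕ 2) (+ 2))))
  go (suc zero) _ eq = inj₂ (n /ℕ 2 , trans eq (cong (λ t → 1ℤ + t) (*-comm (n /ℕ 2) (+ 2))))
  go (suc (suc s)) (ℕ.s≤s (ℕ.s≤s ())) eq

odd-decomp : ∀ n → ¬ + 2 ∣ n → ∃ λ k → n ≡ 1ℤ + + 2 * k
odd-decomp n odd = go (parity n)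
  where
  go : _ → ∃ λ k → n ≡ 1ℤ + + 2 * k
  go (inj₁ (k , eq)) = contradiction (divides k (trans eq (*-comm (+ 2) k))) odd
  go (inj₂ r) = r

-- D may be even here: the module serves odd D with inert primes as well as twice such a D.
module Cancellation (D : ℕ) {{D≢0 : ℕ.NonZero D}} (nonsq : NonSquare (+ D))
  (no-split : ∀ {p} → Prime p → ¬ + p ∣ + 2 → Split p → ¬ + p ∣ + D) where

  OddSplit : ℕ → Set
  OddSplit m = ∀ p → Prime p → p ℕᵈ.∣ m → ¬ + p ∣ + 2 × Split p

  cancel-odd-split : ∀ m → .{{ℕ.NonZero m}} → OddSplit m → ∀ n → Represents (+ D) (+ m * n) → Represents (+ D) n
  cancel-odd-split = prime-ind (λ m → OddSplit m → ∀ n → Represents (+ D) (+ m * n) → Represents (+ D) n)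
    (λ _ n → Represents-cast (+ D) (*-identityˡ n)) step
    where
    step : ∀ p m → Prime p → (OddSplit m → ∀ n → Represents (+ D) (+ m * n) → Represents (+ D) n) →
      OddSplit (p ℕ.* m) → ∀ n → Represents (+ D) (+ (p ℕ.* m) * n) → Represents (+ D) n
    step p m pr rec good n s = rec (λ q qr q∣m → good q qr (ℕᵈ.∣n⇒∣m*n p q∣m)) n
      (cancel-split pr (proj₁ gp) (proj₂ gp) D nonsq (no-split pr (proj₁ gp) (proj₂ gp))
        (Represents-cast (+ D) (trans (cong (_* n) (pos-* p m)) (*-assoc (+ p) (+ m) n)) s))
      where gp = good p pr (ℕᵈ.m∣m*n m)

  -- A prime that divides X² + Y² but not Y makes X / Y a root of -1. Hence an odd sum of coprime
  -- squares has odd split prime factors only, and these can be cancelled one by one.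
  cancel-coprime-norm : ∀ X Y → ¬ + 2 ∣ N (X , Y) → (∀ p → Prime p → + p ∣ X → + p ∣ Y → ¬ + p ∣ + 2 → ⊥) →
    ∀ n → Represents (+ D) (N (X , Y) * n) → Represents (+ D) n
  cancel-coprime-norm X Y odd cop n s =
    cancel-odd-split ∣ N (X , Y) ∣ {{nz}} good n (Represents-cast (+ D) (cong (_* n) (N≡+∣N∣ (X , Y))) s)
    where
    nz : ℕ.NonZero ∣ N (X , Y) ∣
    nz = ℕ.≢-nonZero λ eq → odd (divides 0ℤ (∣i∣≡0⇒i≡0 eq))
    good : OddSplit ∣ N (X , Y) ∣
    good p pr p∣m = p∤2 , ratio-split pr X Y p∣N p∤Y
      where
      p∣N : + p ∣ N (X , Y)
      p∣N = ∣ᵤ⇒∣ p∣m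
      p∤2 : ¬ + p ∣ + 2
      p∤2 d = odd (subst (λ q → + q ∣ N (X , Y)) (∣2⇒≡2 pr d) p∣N)
      p∤Y : ¬ + p ∣ Y
      p∤Y d = cop p pr (euclid-square pr X (∣-lin 1ℤ (- Y) p∣N d (lem X Y))) d p∤2
        where
        lem : ∀ X Y → X * X ≡ 1ℤ * (X * X + Y * Y) + - Y * Y
        lem = solve-∀

  module _ {p : ℕ} (pr : Prime p) (ns : ¬ Split p) (n : ℤ) where

    private
      p∤2 : ¬ + p ∣ + 2
      p∤2 = nonsplit⇒∤2 pr ns

    -- Intersecting the quadric with the line through g and the point 1 trades p² for a sum of two
    -- coprime squares: N(κg − 2A) = n ((κp)² + (4A²)²) when A = Re g and κ = 1 − 4nA².
    cancel-inert-square-line : ∀ A B β → ¬ + p ∣ A → Q (+ D) (A , B) β ≡ + p * + p * n → Represents (+ D) n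
    cancel-inert-square-line A B (c , d) p∤A eq = cancel-coprime-norm X Y odd cop n
        ((κ * A - + 2 * A , κ * B) , (κ * c , κ * d) , trans (lem (+ D) A B c d κ) (trans (cong (λ t → κ * κ * t + + 4 * A * A * (1ℤ - κ)) eq) (lem₂ A n (+ p))))
      where
      -- 1 - κ is n times Y = (2A)², so κ is prime to Y; the 4 makes Y even and κ odd.
      κ = 1ℤ - + 4 * n * (A * A)
      X = κ * + p
      Y = + 4 * (A * A)
      lem : ∀ D A B c d κ → (κ * A - + 2 * A) * (κ * A - + 2 * A) + κ * B * (κ * B) - D * (κ * c * (κ * c) + κ * d * (κ * d)) ≡
        κ * κ * (A * A + B * B - D * (c * c + d * d)) + + 4 * A * A * (1ℤ - κ)
      lem = solve-∀
      lem₂ : ∀ A n p → (1ℤ - + 4 * n * (A * A)) * (1ℤ - + 4 * n * (A * A)) * (p * p * n) + + 4 * A * A * (1ℤ - (1ℤ - + 4 * n * (A * A))) ≡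
        ((1ℤ - + 4 * n * (A * A)) * p * ((1ℤ - + 4 * n * (A * A)) * p) + + 4 * (A * A) * (+ 4 * (A * A))) * n
      lem₂ = solve-∀
      κ-unit : ∀ {q} → Prime q → + q ∣ Y → ¬ + q ∣ κ
      κ-unit qr q∣Y q∣κ = prime∤1 qr (∣-lin 1ℤ n q∣κ q∣Y (lem₃ n A))
        where
        lem₃ : ∀ n A → 1ℤ ≡ 1ℤ * (1ℤ - + 4 * n * (A * A)) + n * (+ 4 * (A * A))
        lem₃ = solve-∀
      p∤Y : ¬ + p ∣ Y
      p∤Y = ∤-* pr (∤-* pr p∤2 p∤2) (∤-* pr p∤A p∤A)
      cop : ∀ q → Prime q → + q ∣ X → + q ∣ Y → ¬ + q ∣ + 2 → ⊥
      cop q qr q∣X q∣Y _ with euclid qr κ (+ p) q∣X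
      ... | inj₁ h = κ-unit qr q∣Y h
      ... | inj₂ h = p∤Y (subst (λ t → + t ∣ Y) (prime∣prime qr pr h) q∣Y)
      2∣Y : + 2 ∣ Y
      2∣Y = divides (+ 2 * (A * A)) (lem₄ (A * A))
        where
        lem₄ : ∀ a → + 4 * a ≡ + 2 * a * + 2
        lem₄ = solve-∀
      odd : ¬ + 2 ∣ N (X , Y)
      odd h = go (euclid prime[2] κ (+ p) (euclid-square prime[2] X (∣-lin 1ℤ (- Y) h 2∣Y (lem₅ X Y))))
        where
        lem₅ : ∀ X Y → X * X ≡ 1ℤ * (X * X + Y * Y) + - Y * Y
        lem₅ = solve-∀
        go : (+ 2 ∣ κ) ⊎ (+ 2 ∣ + p) → ⊥
        go (inj₁ h) = κ-unit prime[2] 2∣Y h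
        go (inj₂ h) = p∤2 (∣-reflexive (cong +_ (sym (prime∣prime prime[2] pr h))))

    -- If p misses a coordinate of α, the line applies. Otherwise p² ∣ D N(β), and p² ∤ D forces p ∣
    -- N(β); as p is inert, it divides α and β, and p² cancels throughout.
    cancel-inert-square : ¬ + p * + p ∣ + D → Represents (+ D) (+ p * + p * n) → Represents (+ D) n
    cancel-inert-square p²∤D ((A , B) , β@(c , d) , eq) = go (+ p ∣? A) (+ p ∣? B)
      where
      go : Dec (+ p ∣ A) → Dec (+ p ∣ B) → Represents (+ D) n
      go (no p∤A) _ = cancel-inert-square-line A B β p∤A eq
      go _ (no p∤B) = cancel-inert-square-line B A β p∤B (trans (cong (_- + D * N β) (N-swap B A)) eq)
      go (yes (divides a A≡)) (yes (divides b B≡)) = go₂ (+ p ∣? N β)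
        where
        D·N : + D * N β ≡ (N (a , b) - n) * (+ p * + p)
        D·N = trans (lem (N (A , B)) (+ D * N β)) (trans (cong₂ _-_ (cong₂ (λ x y → x * x + y * y) A≡ B≡) eq) (lem₂ a b (+ p) n))
          where
          lem : ∀ x y → y ≡ x - (x - y)
          lem = solve-∀
          lem₂ : ∀ a b p n → a * p * (a * p) + b * p * (b * p) - p * p * n ≡ (a * a + b * b - n) * (p * p)
          lem₂ = solve-∀
        go₃ : (+ p ∣ c) × (+ p ∣ d) → Represents (+ D) n
        go₃ (divides c′ c≡ , divides d′ d≡) = (a , b) , (c′ , d′) ,
          cancelˡ (+ p) (prime≢0 pr) (cancelˡ (+ p) (prime≢0 pr)
            (trans (lem (+ D) a b c′ d′ (+ p)) (trans (sym (cong₂ (λ x y → x - + D * y) (cong₂ (λ x y → x * x + y * y) A≡ B≡) (cong₂ (λ x y → x * x + y * y) c≡ d≡))) (trans eq (*-assoc (+ p) (+ p) n)))))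
          where
          lem : ∀ D a b c d p → p * (p * (a * a + b * b - D * (c * c + d * d))) ≡ a * p * (a * p) + b * p * (b * p) - D * (c * p * (c * p) + d * p * (d * p))
          lem = solve-∀
        go₄ : ¬ + p ∣ N β → (+ p ∣ + D) ⊎ (+ p ∣ N β) → Represents (+ D) n
        go₄ p∤N (inj₂ h) = contradiction h p∤N
        go₄ p∤N (inj₁ (divides e D≡)) = go₅ (euclid pr e (N β) (divides (N (a , b) - n)
            (cancelˡ (+ p) (prime≢0 pr) (trans (lem (+ p) e (N β)) (trans (cong (_* N β) (sym D≡)) (trans D·N (lem₂ (N (a , b) - n) (+ p))))))))
          where
          lem : ∀ p e x → p * (e * x) ≡ e * p * x
          lem = solve-∀
          lem₂ : ∀ x p → x * (p * p) ≡ p * (x * p)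
          lem₂ = solve-∀
          go₅ : (+ p ∣ e) ⊎ (+ p ∣ N β) → Represents (+ D) n
          go₅ (inj₂ h) = contradiction h p∤N
          go₅ (inj₁ (divides f e≡)) = contradiction (divides f (trans D≡ (trans (cong (_* + p) e≡) (*-assoc f (+ p) (+ p))))) p²∤D
        go₂ : Dec (+ p ∣ N β) → Represents (+ D) n
        go₂ (yes h) = go₃ (inert-norm pr ns c d h)
        go₂ (no h) = go₄ h (euclid pr (+ D) (N β) (∣-mul (+ p * (N (a , b) - n)) (∣-refl {+ p}) (trans D·N (lem (N (a , b) - n) (+ p)))))
          where
          lem : ∀ x p → x * (p * p) ≡ p * x * p
          lem = solve-∀

  -- The 2-adic counterpart: N(κg - A) = 4κ²c²n + A²(1 - 2κ). As nA² is odd, κ can be chosen with 1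
  -- - 2κ = nA², and the value becomes n((2κc)² + (A²)²), again an odd sum of coprime squares.
  cancel-four-line : ∀ A B β c n → ¬ + 2 ∣ A → ¬ + 2 ∣ n → (∀ q → Prime q → + q ∣ c → + q ∣ + 2) →
    Q (+ D) (A , B) β ≡ + 4 * (c * c) * n → Represents (+ D) n
  cancel-four-line A B (e , f) c n A-odd n-odd c-pow eq = go (odd-decomp (n * (A * A)) (∤-* prime[2] n-odd (∤-* prime[2] A-odd A-odd)))
    where
    go : (∃ λ k → n * (A * A) ≡ 1ℤ + + 2 * k) → Represents (+ D) n
    go (k , k≡) = cancel-coprime-norm X Y odd cop n
        ((κ * A - A , κ * B) , (κ * e , κ * f) , trans (lem (+ D) A B e f κ)
          (trans (cong₂ (λ s t → κ * κ * s + A * A * t) eq 1-2κ) (lem₂ A c n κ)))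
      where
      κ = - k
      X = + 2 * (κ * c)
      Y = A * A
      1-2κ : 1ℤ - + 2 * κ ≡ n * (A * A)
      1-2κ = trans (lem₁ k) (sym k≡)
        where
        lem₁ : ∀ k → 1ℤ - + 2 * (- k) ≡ 1ℤ + + 2 * k
        lem₁ = solve-∀
      lem : ∀ D A B e f κ → (κ * A - A) * (κ * A - A) + κ * B * (κ * B) - D * (κ * e * (κ * e) + κ * f * (κ * f)) ≡
        κ * κ * (A * A + B * B - D * (e * e + f * f)) + A * A * (1ℤ - + 2 * κ)
      lem = solve-∀
      lem₂ : ∀ A c n κ → κ * κ * (+ 4 * (c * c) * n) + A * A * (n * (A * A)) ≡
        (+ 2 * (κ * c) * (+ 2 * (κ * c)) + A * A * (A * A)) * n
      lem₂ = solve-∀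
      2∣X : + 2 ∣ X
      2∣X = divides (κ * c) (*-comm (+ 2) (κ * c))
      odd : ¬ + 2 ∣ N (X , Y)
      odd h = A-odd (euclid-square prime[2] A (euclid-square prime[2] Y (∣-lin 1ℤ (- X) h 2∣X (lem₅ X Y))))
        where
        lem₅ : ∀ X Y → Y * Y ≡ 1ℤ * (X * X + Y * Y) + - X * X
        lem₅ = solve-∀
      cop : ∀ q → Prime q → + q ∣ X → + q ∣ Y → ¬ + q ∣ + 2 → ⊥
      cop q qr q∣X q∣Y q∤2 = ∤-* qr q∤2 (∤-* qr q∤κ (λ h → q∤2 (c-pow q qr h))) q∣X
        where
        q∤κ : ¬ + q ∣ κ
        q∤κ h = prime∤1 qr (∣-lin (+ 2) n h q∣Y (trans (lem₃ κ) (cong (λ t → + 2 * κ + t) 1-2κ)))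
          where
          lem₃ : ∀ κ → 1ℤ ≡ + 2 * κ + (1ℤ - + 2 * κ)
          lem₃ = solve-∀

-- Powers of 2 and arbitrary norms, for D odd with inert primes

pow2 : ℕ → ℤ
pow2 zero = 1ℤ
pow2 (suc e) = + 2 * pow2 e

pow2-+ : ∀ a b → pow2 (a ℕ.+ b) ≡ pow2 a * pow2 b
pow2-+ zero b = sym (*-identityˡ (pow2 b))
pow2-+ (suc a) b = trans (cong (+ 2 *_) (pow2-+ a b)) (sym (*-assoc (+ 2) (pow2 a) (pow2 b)))

prime∣pow2 : ∀ k q → Prime q → + q ∣ pow2 k → + q ∣ + 2
prime∣pow2 zero q qr h = contradiction h (prime∤1 qr)
prime∣pow2 (suc k) q qr h with euclid qr (+ 2) (pow2 k) h
... | inj₁ g = g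
... | inj₂ g = prime∣pow2 k q qr g

ℕ-parity : ∀ e → ∃ λ k → e ≡ k ℕ.+ k ⊎ e ≡ suc (k ℕ.+ k)
ℕ-parity zero = 0 , inj₁ refl
ℕ-parity (suc e) with ℕ-parity e
... | k , inj₁ eq = k , inj₂ (cong suc eq)
... | k , inj₂ eq = suc k , inj₁ (cong suc (trans eq (sym (ℕ.+-suc k k))))

module OddCancellation (D : ℕ) {{D≢0 : ℕ.NonZero D}} (nonsq : NonSquare (+ D))
  (inert : ∀ {p} → Prime p → + p ∣ + D → ¬ Split p)
  (sqf : ∀ {p} → Prime p → ¬ + p * + p ∣ + D) where

  open Cancellation D nonsq (λ pr _ sp d → inert pr d sp)

  private
    D-odd : ¬ + 2 ∣ + D
    D-odd d = inert prime[2] d split-2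

  even-norm : ∀ z → + 2 ∣ N z → ∃ λ w → N z ≡ + 2 * N w
  even-norm z = split-norm prime[2] (1ℤ , 1ℤ) z refl

  odd-coordinate : ∀ A B → ¬ + 2 ∣ N (A , B) → (¬ + 2 ∣ A) ⊎ (¬ + 2 ∣ B)
  odd-coordinate A B odd = go (+ 2 ∣? A) (+ 2 ∣? B)
    where
    go : Dec (+ 2 ∣ A) → Dec (+ 2 ∣ B) → (¬ + 2 ∣ A) ⊎ (¬ + 2 ∣ B)
    go (no h) _ = inj₁ h
    go _ (no h) = inj₂ h
    go (yes a) (yes b) = contradiction (∣-lin A B a b refl) odd

  -- If N(α) is even, so is N(β), D being odd, and both are halved through 1 + i. If N(α) is odd, an
  -- even total exponent has the shape 4c² with c a power of 2; an odd one is made even by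
  -- multiplying by 1 + i on the left.
  cancel-pow2 : ∀ e n → ¬ + 2 ∣ n → Represents (+ D) (pow2 e * n) → Represents (+ D) n
  cancel-pow2 zero n odd s = Represents-cast (+ D) (*-identityˡ n) s
  cancel-pow2 (suc e) n odd (α@(A , B) , β , eq) = go (+ 2 ∣? N α)
    where
    2∣Q : + 2 ∣ Q (+ D) α β
    2∣Q = ∣-mul (pow2 e * n) (∣-refl {+ 2}) (trans eq (lem (pow2 e) n))
      where
      lem : ∀ x n → + 2 * x * n ≡ x * n * + 2
      lem = solve-∀
    halve : (∃ λ w → N α ≡ + 2 * N w) → (∃ λ w → N β ≡ + 2 * N w) → Represents (+ D) (pow2 e * n)
    halve (v , v≡) (w , w≡) = v , w , cancelˡ (+ 2) (λ ()) (trans (lem (N v) (+ D) (N w))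
        (trans (sym (cong₂ (λ x y → x - + D * y) v≡ w≡)) (trans eq (*-assoc (+ 2) (pow2 e) n))))
      where
      lem : ∀ v D w → + 2 * (v - D * w) ≡ + 2 * v - D * (+ 2 * w)
      lem = solve-∀
    2∣Nβ : + 2 ∣ N α → + 2 ∣ N β
    2∣Nβ h = go′ (euclid prime[2] (+ D) (N β) (∣-lin 1ℤ (- 1ℤ) h 2∣Q (lem (N α) (+ D * N β))))
      where
      lem : ∀ x y → y ≡ 1ℤ * x + - 1ℤ * (x - y)
      lem = solve-∀
      go′ : _ ⊎ _ → + 2 ∣ N β
      go′ (inj₁ h) = contradiction h D-odd
      go′ (inj₂ h) = h
    even-exponent : ∀ k → e ≡ suc (k ℕ.+ k) → (¬ + 2 ∣ A) ⊎ (¬ + 2 ∣ B) → Represents (+ D) n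
    even-exponent k e≡ = go′
      where
      eq′ : Q (+ D) α β ≡ + 4 * (pow2 k * pow2 k) * n
      eq′ = trans eq (cong (_* n) (trans (cong (λ t → + 2 * pow2 t) e≡) (trans (lem (pow2 (k ℕ.+ k))) (cong (+ 4 *_) (pow2-+ k k)))))
        where
        lem : ∀ x → + 2 * (+ 2 * x) ≡ + 4 * x
        lem = solve-∀
      go′ : (¬ + 2 ∣ A) ⊎ (¬ + 2 ∣ B) → Represents (+ D) n
      go′ (inj₁ h) = cancel-four-line A B β (pow2 k) n h odd (prime∣pow2 k) eq′
      go′ (inj₂ h) = cancel-four-line B A β (pow2 k) n h odd (prime∣pow2 k) (trans (cong (_- + D * N β) (N-swap B A)) eq′)
    odd-exponent : ∀ k → e ≡ k ℕ.+ k → ¬ + 2 ∣ N α → Represents (+ D) n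
    odd-exponent k e≡ α-odd = cancel-four-line (A - B) (A + B) ((1ℤ , 1ℤ) ⊗ β) (pow2 k) n A-B-odd odd (prime∣pow2 k)
        (trans (cong₂ (λ x y → x - + D * y) (lem₁ A B) (N-⊗ (1ℤ , 1ℤ) β)) (trans (lem₂ (N α) (+ D) (N β))
          (trans (cong (+ 2 *_) eq) (trans (cong (λ t → + 2 * (+ 2 * pow2 t * n)) e≡) (trans (cong (λ t → + 2 * (+ 2 * t * n)) (pow2-+ k k)) (lem₃ (pow2 k) n))))))
      where
      lem₁ : ∀ A B → (A - B) * (A - B) + (A + B) * (A + B) ≡ + 2 * (A * A + B * B)
      lem₁ = solve-∀
      lem₂ : ∀ a D b → + 2 * a - D * (+ 2 * b) ≡ + 2 * (a - D * b)
      lem₂ = solve-∀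
      lem₃ : ∀ k n → + 2 * (+ 2 * (k * k) * n) ≡ + 4 * (k * k) * n
      lem₃ = solve-∀
      A-B-odd : ¬ + 2 ∣ A - B
      A-B-odd h = α-odd (∣-lin (A - B) (A * B) h (∣-refl {+ 2}) (lem A B))
        where
        lem : ∀ A B → A * A + B * B ≡ (A - B) * (A - B) + A * B * + 2
        lem = solve-∀
    go₂ : ¬ + 2 ∣ N α → (∃ λ k → e ≡ k ℕ.+ k ⊎ e ≡ suc (k ℕ.+ k)) → Represents (+ D) n
    go₂ h (k , inj₁ e≡) = odd-exponent k e≡ h
    go₂ h (k , inj₂ e≡) = even-exponent k e≡ (odd-coordinate A B h)
    go : Dec (+ 2 ∣ N α) → Represents (+ D) n
    go (yes h) = cancel-pow2 e n odd (halve (even-norm α h) (even-norm β (2∣Nβ h)))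
    go (no h) = go₂ h (ℕ-parity e)

  -- `cancel-split` works at odd primes only, so the factors 2 of N(γ) are collected here and
  -- removed together at the end.
  UpToPow2 : ℤ → Set
  UpToPow2 n = ∃ λ e → Represents (+ D) (pow2 e * n)

  -- Induction on κ by its prime factors p. An odd split p cancels and 2 is moved into n, and the
  -- cofactor stays a norm; an inert p divides γ itself, so it leaves as p².
  cancel-norm-upto-pow2 : ∀ κ → .{{ℕ.NonZero κ}} → ∀ γ n → N γ ≡ + κ → Represents (+ D) (+ κ * n) → UpToPow2 n
  cancel-norm-upto-pow2 (suc κ) = <-rec (λ κ → ∀ γ n → N γ ≡ + suc κ → Represents (+ D) (+ suc κ * n) → UpToPow2 n) step κ
    where
    step : ∀ κ → (∀ {J} → J ℕ.< κ → ∀ γ n → N γ ≡ + suc J → Represents (+ D) (+ suc J * n) → UpToPow2 n) →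
      ∀ γ n → N γ ≡ + suc κ → Represents (+ D) (+ suc κ * n) → UpToPow2 n
    step κ rec γ n Nγ s = go (prime-divisor (suc κ))
      where
      recurse : ∀ J → J ℕ.< suc κ → .{{ℕ.NonZero J}} → ∀ γ n → N γ ≡ + J → Represents (+ D) (+ J * n) → UpToPow2 n
      recurse (suc J) (ℕ.s≤s lt) = rec lt
      go₂ : ∀ p J → Prime p → suc κ ≡ J ℕ.* p → Dec (Split p) → Dec (+ p ∣ + 2) → UpToPow2 n
      go₂ p zero pr () _ _
      go₂ p J@(suc _) pr eq (yes sp) 2? = go₃ (split⇒norm {{prime⇒nonZero pr}} sp) 2?
        where
        J< : J ℕ.< suc κ
        J< = subst (J ℕ.<_) (sym eq) (ℕ.m<m*n J p (ℕ.nonTrivial⇒n>1 p {{prime⇒nonTrivial pr}}))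
        eqℤ : + suc κ ≡ + p * + J
        eqℤ = trans (cong +_ (trans eq (ℕ.*-comm J p))) (pos-* p J)
        s′ : Represents (+ D) (+ p * (+ J * n))
        s′ = Represents-cast (+ D) (trans (cong (_* n) eqℤ) (*-assoc (+ p) (+ J) n)) s
        go₄ : Dec (+ p ∣ + 2) → (∃ λ w → N γ ≡ + p * N w) → UpToPow2 n
        go₄ 2? (w , w≡) = go₅ 2?
          where
          Nw : N w ≡ + J
          Nw = cancelˡ (+ p) (prime≢0 pr) (trans (sym w≡) (trans Nγ eqℤ))
          double : UpToPow2 (+ 2 * n) → UpToPow2 n
          double (e , t) = suc e , Represents-cast (+ D) (lem (pow2 e) n) t
            where
            lem : ∀ x n → x * (+ 2 * n) ≡ + 2 * x * n
            lem = solve-∀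
          go₅ : Dec (+ p ∣ + 2) → UpToPow2 n
          go₅ (no p∤2) = recurse J J< w n Nw (cancel-split pr p∤2 sp D nonsq (λ d → inert pr d sp) s′)
          go₅ (yes p∣2) = double (recurse J J< w (+ 2 * n) Nw (Represents-cast (+ D) (trans (lem (+ p) (+ J) n) (cong (λ t → + J * (+ t * n)) (∣2⇒≡2 pr p∣2))) s′))
            where
            lem : ∀ p J n → p * (J * n) ≡ J * (p * n)
            lem = solve-∀
        go₃ : (∃ λ π → + p ≡ N π) → Dec (+ p ∣ + 2) → UpToPow2 n
        go₃ (π , Nπ) 2? = go₄ 2? (split-norm pr π γ Nπ (∣-mul (+ J) (∣-refl {+ p}) (trans Nγ (trans eqℤ (*-comm (+ p) (+ J))))))
      go₂ p J@(suc _) pr eq (no ns) _ = go₃ γ Nγ (inert-norm pr ns (proj₁ γ) (proj₂ γ) (∣-mul (+ J) (∣-refl {+ p}) (trans Nγ eqℤ)))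
        where
        eqℤ : + suc κ ≡ + J * + p
        eqℤ = trans (cong +_ eq) (pos-* J p)
        go₃ : ∀ γ → N γ ≡ + suc κ → (+ p ∣ proj₁ γ) × (+ p ∣ proj₂ γ) → UpToPow2 n
        go₃ (x , y) Nγ (divides a a≡ , divides b b≡) = recurse ∣ N (a , b) ∣ small {{nz}} (a , b) n (N≡+∣N∣ (a , b))
            (cancel-inert-square pr ns (+ ∣ N (a , b) ∣ * n) (sqf pr) (Represents-cast (+ D) (trans (cong (_* n) κ≡) (*-assoc (+ p * + p) (+ ∣ N (a , b) ∣) n)) s))
          where
          M = ∣ N (a , b) ∣
          κ≡ : + suc κ ≡ + p * + p * + M
          κ≡ = trans (sym Nγ) (trans (cong₂ (λ x y → x * x + y * y) a≡ b≡) (trans (lem a b (+ p)) (cong (+ p * + p *_) (N≡+∣N∣ (a , b)))))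
            where
            lem : ∀ a b p → a * p * (a * p) + b * p * (b * p) ≡ p * p * (a * a + b * b)
            lem = solve-∀
          κ≡ℕ : suc κ ≡ M ℕ.* (p ℕ.* p)
          κ≡ℕ = +-injective (trans κ≡ (trans (cong (_* + M) (sym (pos-* p p))) (trans (sym (pos-* (p ℕ.* p) M)) (cong +_ (ℕ.*-comm (p ℕ.* p) M)))))
          nz : ℕ.NonZero M
          nz = ℕ.≢-nonZero λ M≡0 → contradiction (trans κ≡ℕ (cong (ℕ._* (p ℕ.* p)) M≡0)) λ ()
          p>1 : 1 ℕ.< p
          p>1 = ℕ.nonTrivial⇒n>1 p {{prime⇒nonTrivial pr}}
          small : M ℕ.< suc κ
          small = subst (M ℕ.<_) (sym κ≡ℕ) (ℕ.m<m*n M (p ℕ.* p) {{nz}} (ℕ.<-≤-trans p>1 (ℕ.m≤m*n p p {{prime⇒nonZero pr}})))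
      go : (suc κ ≡ 1) ⊎ (∃ λ p → Prime p × p ℕᵈ.∣ suc κ) → UpToPow2 n
      go (inj₁ eq) = 0 , Represents-cast (+ D) (cong (λ t → + t * n) eq) s
      go (inj₂ (p , pr , ℕᵈ.divides J eq)) = go₂ p J pr eq (split? p {{prime⇒nonZero pr}}) (+ p ∣? + 2)

  cancel-norm : ∀ γ n → N γ ≢ 0ℤ → ¬ + 2 ∣ n → Represents (+ D) (n * N γ) → Represents (+ D) n
  cancel-norm γ n Nγ≢0 odd s = go (cancel-norm-upto-pow2 ∣ N γ ∣ {{≢-nonZero Nγ≢0}} γ n (N≡+∣N∣ γ)
      (Represents-cast (+ D) (trans (*-comm n (N γ)) (cong (_* n) (N≡+∣N∣ γ))) s))
    where
    go : UpToPow2 n → Represents (+ D) n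
    go (e , t) = cancel-pow2 e n odd t

-- Legendre descent

module _ {p : ℕ} (pr : Prime p) where

  ∤-small : ∀ n → .{{ℕ.NonZero n}} → n ℕ.< p → ¬ + p ∣ + n
  ∤-small n lt d = ℕᵈ.>⇒∤ lt (∣⇒∣ᵤ d)

  squares-distinct-< : ∀ h a b → h ℕ.+ h ℕ.≤ p → b ℕ.≤ h → a ℕ.< b → ¬ + p ∣ (+ b - + a) * (+ b + + a)
  squares-distinct-< h a b 2h≤p b≤h a<b d = go (ℕ.m≤n⇒∃[o]m+o≡n a<b)
    where
    go : (∃ λ k → suc a ℕ.+ k ≡ b) → ⊥
    go (k , refl) = ∤-* pr
      (λ e → ∤-small (suc k) k<p (subst (+ p ∣_) (lem (+ a) (+ k)) e))
      (∤-small (suc a ℕ.+ k ℕ.+ a) sum<p) d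
      where
      lem : ∀ a k → 1ℤ + a + k - a ≡ 1ℤ + k
      lem = solve-∀
      sum<p : suc a ℕ.+ k ℕ.+ a ℕ.< p
      sum<p = ℕ.<-≤-trans (ℕ.+-monoʳ-< (suc a ℕ.+ k) a<b) (ℕ.≤-trans (ℕ.+-mono-≤ b≤h b≤h) 2h≤p)
      k<p : suc k ℕ.< p
      k<p = ℕ.≤-<-trans (ℕ.s≤s (ℕ.m≤n+m k a)) (ℕ.≤-<-trans (ℕ.m≤m+n _ a) sum<p)

  squares-distinct : ∀ h a b → h ℕ.+ h ℕ.≤ p → a ℕ.≤ h → b ℕ.≤ h → a ≢ b → ¬ + p ∣ + a * + a - + b * + b
  squares-distinct h a b 2h≤p a≤h b≤h a≢b d = go (ℕ.<-cmp a b)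
    where
    lem₁ : ∀ a b → (b - a) * (b + a) ≡ - 1ℤ * (a * a - b * b)
    lem₁ = solve-∀
    lem₂ : ∀ a b → (a - b) * (a + b) ≡ 1ℤ * (a * a - b * b)
    lem₂ = solve-∀
    go : _ → ⊥
    go (tri< lt _ _) = squares-distinct-< h a b 2h≤p b≤h lt (∣-mul (- 1ℤ) d (lem₁ (+ a) (+ b)))
    go (tri≈ _ eq _) = a≢b eq
    go (tri> _ _ gt) = squares-distinct-< h b a 2h≤p a≤h gt (∣-mul 1ℤ d (lem₂ (+ a) (+ b)))

  residue : ℤ → Fin p
  residue z = fromℕ< (n%ℕd<d z p {{prime⇒nonZero pr}})

  residue-injective : ∀ y z → residue y ≡ residue z → + p ∣ y - z
  residue-injective y z eq = divides (y /ℕ p - z /ℕ p) (trans (cong₂ _-_ y≡ z≡)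
      (trans (cong (λ t → + t + y /ℕ p * + p - (+ (z %ℕ p) + z /ℕ p * + p)) rem≡) (lem (+ (z %ℕ p)) (y /ℕ p) (z /ℕ p) (+ p))))
    where
    instance
      _ = prime⇒nonZero pr
    y≡ = a≡a%ℕn+[a/ℕn]*n y p
    z≡ = a≡a%ℕn+[a/ℕn]*n z p
    rem≡ : y %ℕ p ≡ z %ℕ p
    rem≡ = Fin.fromℕ<-injective _ _ (n%ℕd<d y p) (n%ℕd<d z p) eq
    lem : ∀ s a b p → s + a * p - (s + b * p) ≡ (a - b) * p
    lem = solve-∀

  SumOfSquaresMod : ℕ → ℤ → Set
  SumOfSquaresMod h m = ∃₂ λ a b → a ℕ.≤ h × b ℕ.≤ h × + p ∣ N (+ a , + b) - m

  module _ (h : ℕ) (2h≤p : h ℕ.+ h ℕ.≤ p) (p≤ : p ℕ.≤ suc (h ℕ.+ h)) (m : ℤ) where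

    private
      g : Fin (suc h) ⊎ Fin (suc h) → ℤ
      g (inj₁ a) = + toℕ a * + toℕ a
      g (inj₂ b) = m - + toℕ b * + toℕ b

      bound : (a : Fin (suc h)) → toℕ a ℕ.≤ h
      bound a = ℕ.≤-pred (Fin.toℕ<n a)

      collide : ∀ u v → u ≢ v → + p ∣ g u - g v → SumOfSquaresMod h m
      collide (inj₁ a) (inj₁ b) u≢v d = contradiction d (squares-distinct h (toℕ a) (toℕ b) 2h≤p (bound a) (bound b) (λ e → u≢v (cong inj₁ (Fin.toℕ-injective e))))
      collide (inj₂ a) (inj₂ b) u≢v d = contradiction (∣-mul (- 1ℤ) d (lem m (+ toℕ a * + toℕ a) (+ toℕ b * + toℕ b)))
          (squares-distinct h (toℕ a) (toℕ b) 2h≤p (bound a) (bound b) (λ e → u≢v (cong inj₂ (Fin.toℕ-injective e))))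
        where
        lem : ∀ m a b → a - b ≡ - 1ℤ * (m - a - (m - b))
        lem = solve-∀
      collide (inj₁ a) (inj₂ b) _ d = toℕ a , toℕ b , bound a , bound b , ∣-mul 1ℤ d (lem m (+ toℕ a * + toℕ a) (+ toℕ b * + toℕ b))
        where
        lem : ∀ m a b → a + b - m ≡ 1ℤ * (a - (m - b))
        lem = solve-∀
      collide (inj₂ b) (inj₁ a) _ d = toℕ a , toℕ b , bound a , bound b , ∣-mul (- 1ℤ) d (lem m (+ toℕ a * + toℕ a) (+ toℕ b * + toℕ b))
        where
        lem : ∀ m a b → a + b - m ≡ - 1ℤ * ((m - b) - a)
        lem = solve-∀

    -- The h + 1 squares a² and the h + 1 numbers m - b² outnumber the residues modulo p. Within one
    -- kind the residues are distinct, so a collision joins the two kinds.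
    sum-of-squares-mod′ : SumOfSquaresMod h m
    sum-of-squares-mod′ = go (Fin.pigeonhole p< (λ i → residue (g (splitAt (suc h) i))))
      where
      p< : p ℕ.< suc h ℕ.+ suc h
      p< = ℕ.s≤s (subst (p ℕ.≤_) (sym (ℕ.+-suc h h)) p≤)
      go : _ → SumOfSquaresMod h m
      go (i , j , i<j , eq) = collide (splitAt (suc h) i) (splitAt (suc h) j)
        (λ e → Fin.<⇒≢ i<j (splitAt-injective i j e)) (residue-injective (g (splitAt (suc h) i)) (g (splitAt (suc h) j)) eq)
        where
        splitAt-injective : ∀ (i j : Fin (suc h ℕ.+ suc h)) → splitAt (suc h) i ≡ splitAt (suc h) j → i ≡ j
        splitAt-injective i j e = trans (sym (Fin.join-splitAt (suc h) (suc h) i)) (trans (cong (Fin.join (suc h) (suc h)) e) (Fin.join-splitAt (suc h) (suc h) j))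

  -- The slack 2 is for m = -1, where a² + b² + 1 must stay below p²; the bound is attained at p =
  -- 2.
  sum-of-squares-mod : ∀ m → ∃₂ λ a b → a ℕ.* a ℕ.+ b ℕ.* b ℕ.+ 2 ℕ.≤ p ℕ.* p × + p ∣ N (+ a , + b) - m
  sum-of-squares-mod m = go (ℕ-parity p)
    where
    small : ∀ h a b → h ℕ.+ h ℕ.≤ p → a ℕ.≤ h → b ℕ.≤ h → a ℕ.* a ℕ.+ b ℕ.* b ℕ.+ 2 ℕ.≤ p ℕ.* p
    small h a b 2h≤p a≤h b≤h = ℕ.*-cancelˡ-≤ 4 (begin
      4 ℕ.* (a ℕ.* a ℕ.+ b ℕ.* b ℕ.+ 2)
        ≡⟨ +-injective (trans (pos-* 4 (a ℕ.* a ℕ.+ b ℕ.* b ℕ.+ 2)) (trans (cong (λ t → + 4 * (t + + 2)) (cong₂ _+_ (pos-* a a) (pos-* b b)))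
             (trans (lem (+ a) (+ b)) (cong₂ (λ s t → s + t + + 4 + + 4) (sym (pos-* (a ℕ.+ a) (a ℕ.+ a))) (sym (pos-* (b ℕ.+ b) (b ℕ.+ b))))))) ⟩
      (a ℕ.+ a) ℕ.* (a ℕ.+ a) ℕ.+ (b ℕ.+ b) ℕ.* (b ℕ.+ b) ℕ.+ 4 ℕ.+ 4
        ≤⟨ ℕ.+-mono-≤ (ℕ.+-mono-≤ (ℕ.+-mono-≤ (ℕ.*-mono-≤ (2≤ a≤h) (2≤ a≤h)) (ℕ.*-mono-≤ (2≤ b≤h) (2≤ b≤h))) 4≤) 4≤ ⟩
      p ℕ.* p ℕ.+ p ℕ.* p ℕ.+ p ℕ.* p ℕ.+ p ℕ.* p
        ≡⟨ +-injective (trans (lem₂ (+ (p ℕ.* p))) (sym (pos-* 4 (p ℕ.* p)))) ⟩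
      4 ℕ.* (p ℕ.* p) ∎)
      where
      open ℕ.≤-Reasoning
      2≤ : ∀ {a} → a ℕ.≤ h → a ℕ.+ a ℕ.≤ p
      2≤ a≤h = ℕ.≤-trans (ℕ.+-mono-≤ a≤h a≤h) 2h≤p
      p>1 : 1 ℕ.< p
      p>1 = ℕ.nonTrivial⇒n>1 p {{prime⇒nonTrivial pr}}
      4≤ : 4 ℕ.≤ p ℕ.* p
      4≤ = ℕ.*-mono-≤ p>1 p>1
      lem : ∀ a b → + 4 * (a * a + b * b + + 2) ≡ (a + a) * (a + a) + (b + b) * (b + b) + + 4 + + 4
      lem = solve-∀
      lem₂ : ∀ q → q + q + q + q ≡ + 4 * q
      lem₂ = solve-∀
    finish : ∀ h → h ℕ.+ h ℕ.≤ p → SumOfSquaresMod h m → _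
    finish h 2h≤p (a , b , a≤h , b≤h , d) = a , b , small h a b 2h≤p a≤h b≤h , d
    go : _ → _
    go (h , inj₁ eq) = finish h (ℕ.≤-reflexive (sym eq)) (sum-of-squares-mod′ h (ℕ.≤-reflexive (sym eq)) (ℕ.≤-trans (ℕ.≤-reflexive eq) (ℕ.n≤1+n _)) m)
    go (h , inj₂ eq) = finish h 2h≤p (sum-of-squares-mod′ h 2h≤p (ℕ.≤-reflexive eq) m)
      where
      2h≤p : h ℕ.+ h ℕ.≤ p
      2h≤p = ℕ.≤-trans (ℕ.n≤1+n _) (ℕ.≤-reflexive (sym eq))

-- y is a norm of ℚ(i) ⊕ ℚ(i)j, j² = x, up to norms from ℚ(i); symmetric in x and y.
QNorm : ℤ → ℤ → Set
QNorm x y = ∃ λ α → ∃₂ λ β γ → N γ ≢ 0ℤ × Q x α β ≡ y * N γ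

*-≢0 : ∀ {a b} → a ≢ 0ℤ → b ≢ 0ℤ → a * b ≢ 0ℤ
*-≢0 {a} a≢0 b≢0 eq with i*j≡0⇒i≡0∨j≡0 a eq
... | inj₁ h = a≢0 h
... | inj₂ h = b≢0 h

N-⊗-≢0 : ∀ z w → N z ≢ 0ℤ → N w ≢ 0ℤ → N (z ⊗ w) ≢ 0ℤ
N-⊗-≢0 z w hz hw eq = *-≢0 hz hw (trans (sym (N-⊗ z w)) eq)

QNorm-norm : ∀ x z → QNorm x (N z)
QNorm-norm x z = z , (0ℤ , 0ℤ) , (1ℤ , 0ℤ) , (λ ()) , lem x (N z)
  where
  lem : ∀ x n → n - x * 0ℤ ≡ n * 1ℤ
  lem = solve-∀

QNorm-mul : ∀ x y z → QNorm x y → QNorm x z → QNorm x (y * z)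
QNorm-mul x y z (α , β , γ , γ≢0 , eq) (α′ , β′ , γ′ , γ′≢0 , eq′) =
  proj₁ (qmul x (α , β) (α′ , β′)) , proj₂ (qmul x (α , β) (α′ , β′)) , γ ⊗ γ′ , N-⊗-≢0 γ γ′ γ≢0 γ′≢0 ,
  trans (Q-mul x (α , β) (α′ , β′)) (trans (cong₂ _*_ eq eq′) (trans (lem y z (N γ) (N γ′)) (cong (y * z *_) (sym (N-⊗ γ γ′)))))
  where
  lem : ∀ y z a b → y * a * (z * b) ≡ y * z * (a * b)
  lem = solve-∀

QNorm-square : ∀ x y z → z ≢ 0ℤ → QNorm x (y * z * z) → QNorm x y
QNorm-square x y z z≢0 (α , β , γ , γ≢0 , eq) = α , β , (z , 0ℤ) ⊗ γ ,
  (λ e → *-≢0 (*-≢0 z≢0 z≢0) γ≢0 (trans (sym (N-scale z γ)) e)) ,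
  trans eq (trans (lem y z (N γ)) (cong (y *_) (sym (N-scale z γ))))
  where
  lem : ∀ y z n → y * z * z * n ≡ y * (z * z * n)
  lem = solve-∀

-- Values form a group modulo norms, squares included: y is (yz)z up to z².
QNorm-cancel : ∀ x y z → z ≢ 0ℤ → QNorm x (y * z) → QNorm x z → QNorm x y
QNorm-cancel x y z z≢0 s t = QNorm-square x y z z≢0 (QNorm-mul x (y * z) z s t)

QNorm-sym : ∀ x y → y ≢ 0ℤ → QNorm x y → QNorm y x
QNorm-sym x y y≢0 (α , β , γ , γ≢0 , eq) = go (N β ≟ 0ℤ)
  where
  go : Dec (N β ≡ 0ℤ) → QNorm y x
  go (no β≢0) = α , γ , β , β≢0 , trans (cong (λ t → N α - t) (sym eq)) (lem (N α) (x * N β))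
    where
    lem : ∀ a b → a - (a - b) ≡ b
    lem = solve-∀
  -- N α = y N γ makes the form hyperbolic: (x+1)² − (x−1)² = 4x.
  go (yes β≡0) = (x + 1ℤ , 0ℤ) ⊗ α , (x - 1ℤ , 0ℤ) ⊗ γ , (+ 2 , 0ℤ) ⊗ α ,
      (λ e → *-≢0 {+ 4} (λ ()) α≢0 (trans (sym (N-scale (+ 2) α)) e)) ,
      trans (cong₂ (λ s t → s - y * t) (N-scale (x + 1ℤ) α) (N-scale (x - 1ℤ) γ))
        (trans (lem₁ x y (N α) (N γ)) (trans (cong (λ t → (x + 1ℤ) * (x + 1ℤ) * N α - (x - 1ℤ) * (x - 1ℤ) * t) (sym α≡))
          (trans (lem₂ x (N α)) (cong (x *_) (sym (N-scale (+ 2) α))))))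
    where
    α≡ : N α ≡ y * N γ
    α≡ = trans (trans (lem x (N α)) (cong (λ t → N α - x * t) (sym β≡0))) eq
      where
      lem : ∀ x a → a ≡ a - x * 0ℤ
      lem = solve-∀
    α≢0 : N α ≢ 0ℤ
    α≢0 e = *-≢0 y≢0 γ≢0 (trans (sym α≡) e)
    lem₁ : ∀ x y a c → (x + 1ℤ) * (x + 1ℤ) * a - y * ((x - 1ℤ) * (x - 1ℤ) * c) ≡ (x + 1ℤ) * (x + 1ℤ) * a - (x - 1ℤ) * (x - 1ℤ) * (y * c)
    lem₁ = solve-∀
    lem₂ : ∀ x a → (x + 1ℤ) * (x + 1ℤ) * a - (x - 1ℤ) * (x - 1ℤ) * a ≡ x * (+ 2 * + 2 * a)
    lem₂ = solve-∀

QNorm-congruence : ∀ x p y a b → N (+ a , + b) - x ≡ p * y → QNorm x (p * y)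
QNorm-congruence x p y a b eq = (+ a , + b) , (1ℤ , 0ℤ) , (1ℤ , 0ℤ) , (λ ()) , trans (lem (N (+ a , + b)) x) (trans eq (sym (*-identityʳ (p * y))))
  where
  lem : ∀ a x → a - x * 1ℤ ≡ a - x
  lem = solve-∀

data Factor (n : ℕ) : Set where
  unit : n ≡ 1 → Factor n
  prime : Prime n → Factor n
  composite : ∀ a b → .{{ℕ.NonZero a}} → .{{ℕ.NonZero b}} → a ℕ.< n → b ℕ.< n → n ≡ a ℕ.* b → Factor n

factor : ∀ n → .{{ℕ.NonZero n}} → Factor n
factor n@(suc _) = go (prime-divisor n)
  where
  go : n ≡ 1 ⊎ (∃ λ p → Prime p × p ℕᵈ.∣ n) → Factor n
  go (inj₁ eq) = unit eq
  go (inj₂ (p , pr , ℕᵈ.divides zero ()))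
  go (inj₂ (p , pr , ℕᵈ.divides 1 eq)) = prime (subst Prime (sym (trans eq (ℕ.*-identityˡ p))) pr)
  go (inj₂ (p , pr , ℕᵈ.divides J@(suc (suc _)) eq)) = composite J p
    {{_}} {{prime⇒nonZero pr}}
    (subst (J ℕ.<_) (sym eq) (ℕ.m<m*n J p (ℕ.nonTrivial⇒n>1 p {{prime⇒nonTrivial pr}})))
    (subst (p ℕ.<_) (sym (trans eq (ℕ.*-comm J p))) (ℕ.m<m*n p J {{prime⇒nonZero pr}} (ℕ.s≤s (ℕ.s≤s ℕ.z≤n))))
    eq

QNorm-product : ∀ x n a b → n ≡ a ℕ.* b → QNorm x (+ a) → QNorm x (+ b) → QNorm x (+ n)
QNorm-product x n a b eq s t = subst (QNorm x) (trans (sym (pos-* a b)) (cong +_ (sym eq))) (QNorm-mul x (+ a) (+ b) s t)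

QNorm-one : ∀ x n → n ≡ 1 → QNorm x (+ n)
QNorm-one x n eq = subst (λ t → QNorm x (+ t)) (sym eq) (QNorm-norm x (1ℤ , 0ℤ))

quotient< : ∀ p y s → y ℕ.* p ≡ s → s ℕ.< p ℕ.* p → y ℕ.< p
quotient< p y s eq lt = ℕ.*-cancelʳ-< p y p (subst (ℕ._< p ℕ.* p) (sym eq) lt)

-- The rational four-square theorem: a prime p divides some a² + b² + 1 = py with y < p, and y is
-- known by induction. Its purpose is the sign: by symmetry -1 becomes a value for every positive m.
QNorm-minus-one : ∀ n → .{{ℕ.NonZero n}} → QNorm -1ℤ (+ n)
QNorm-minus-one (suc n) = <-rec (λ n → QNorm -1ℤ (+ suc n)) step n
  where
  step : ∀ n → (∀ {m} → m ℕ.< n → QNorm -1ℤ (+ suc m)) → QNorm -1ℤ (+ suc n)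
  step n rec = go (factor (suc n))
    where
    recurse : ∀ m → .{{ℕ.NonZero m}} → m ℕ.< suc n → QNorm -1ℤ (+ m)
    recurse (suc m) (ℕ.s≤s lt) = rec lt
    go : Factor (suc n) → QNorm -1ℤ (+ suc n)
    go (unit eq) = QNorm-one -1ℤ (suc n) eq
    go (composite a b a< b< eq) = QNorm-product -1ℤ (suc n) a b eq (recurse a a<) (recurse b b<)
    go (prime pr) = go₂ (sum-of-squares-mod pr -1ℤ)
      where
      p = suc n
      go₂ : (∃₂ λ a b → a ℕ.* a ℕ.+ b ℕ.* b ℕ.+ 2 ℕ.≤ p ℕ.* p × + p ∣ N (+ a , + b) - -1ℤ) → QNorm -1ℤ (+ p)
      go₂ (a , b , small , d) = go₃ (∣⇒∣ᵤ (subst (+ p ∣_) cast d))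
        where
        s = suc (a ℕ.* a ℕ.+ b ℕ.* b)
        cast : N (+ a , + b) - -1ℤ ≡ + s
        cast = trans (cong (_- -1ℤ) (cong₂ _+_ (sym (pos-* a a)) (sym (pos-* b b)))) (+-comm (+ (a ℕ.* a ℕ.+ b ℕ.* b)) 1ℤ)
        go₃ : p ℕᵈ.∣ s → QNorm -1ℤ (+ p)
        go₃ (ℕᵈ.divides zero ())
        go₃ (ℕᵈ.divides y@(suc _) eq) = QNorm-cancel -1ℤ (+ p) (+ y) (λ ())
          (QNorm-congruence -1ℤ (+ p) (+ y) a b (trans cast (trans (cong +_ (trans eq (ℕ.*-comm y p))) (pos-* p y))))
          (recurse y (quotient< p y s (sym eq) (subst (ℕ._≤ p ℕ.* p) (ℕ.+-comm (a ℕ.* a ℕ.+ b ℕ.* b) 2) small)))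

QNorm-signed : ∀ x → QNorm x -1ℤ → ∀ y → QNorm x (+ ∣ y ∣) → QNorm x y
QNorm-signed x neg (+ n) s = s
QNorm-signed x neg y@(-[1+ n ]) s = subst (QNorm x) (-1*i≡-i (+ suc n)) (QNorm-mul x -1ℤ (+ suc n) neg s)

QNorm-neg : ∀ m → .{{ℕ.NonZero m}} → QNorm (+ m) -1ℤ
QNorm-neg m@(suc _) = QNorm-sym -1ℤ (+ m) (λ ()) (QNorm-minus-one m)

-- By symmetry m ≤ n, and by multiplicativity n is prime. Then a² + b² - m = ny with ∣y∣ < n, so y
-- is a value by induction, up to sign, and n follows by cancelling y. If y = 0, m itself is a norm.
QNorm-pos : ∀ m n → .{{ℕ.NonZero m}} → .{{ℕ.NonZero n}} → QNorm (+ m) (+ n)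
QNorm-pos m n = <-rec P step (m ℕ.+ n) m n refl
  where
  P : ℕ → Set
  P s = ∀ m n → s ≡ m ℕ.+ n → .{{ℕ.NonZero m}} → .{{ℕ.NonZero n}} → QNorm (+ m) (+ n)
  step : ∀ s → (∀ {t} → t ℕ.< s → P t) → P s
  step s rec m n s≡ = go (ℕ.≤-total m n)
    where
    core : ∀ m n → s ≡ m ℕ.+ n → .{{ℕ.NonZero m}} → .{{ℕ.NonZero n}} → m ℕ.≤ n → QNorm (+ m) (+ n)
    core m@(suc _) n@(suc _) s≡ m≤n = go₁ (factor n)
      where
      recurse : ∀ k → .{{ℕ.NonZero k}} → k ℕ.< n → QNorm (+ m) (+ k)
      recurse k k< = rec (subst (m ℕ.+ k ℕ.<_) (sym s≡) (ℕ.+-monoʳ-< m k<)) m k refl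
      go₁ : Factor n → QNorm (+ m) (+ n)
      go₁ (unit eq) = QNorm-one (+ m) n eq
      go₁ (composite a b a< b< eq) = QNorm-product (+ m) n a b eq (recurse a a<) (recurse b b<)
      go₁ (prime pr) = go₂ (sum-of-squares-mod pr (+ m))
        where
        go₂ : (∃₂ λ a b → a ℕ.* a ℕ.+ b ℕ.* b ℕ.+ 2 ℕ.≤ n ℕ.* n × + n ∣ N (+ a , + b) - + m) → QNorm (+ m) (+ n)
        go₂ (a , b , small , divides y eq) = go₃ y eq (y ≟ 0ℤ)
          where
          cast : N (+ a , + b) ≡ + (a ℕ.* a ℕ.+ b ℕ.* b)
          cast = cong₂ _+_ (sym (pos-* a a)) (sym (pos-* b b))
          lt : ∣ N (+ a , + b) - + m ∣ ℕ.< n ℕ.* n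
          lt = subst (λ t → ∣ t - + m ∣ ℕ.< n ℕ.* n) (sym cast)
            (ℕ.≤-<-trans (subst (λ t → ∣ t ∣ ℕ.≤ (a ℕ.* a ℕ.+ b ℕ.* b) ℕ.⊔ m) (sym (m-n≡m⊖n (a ℕ.* a ℕ.+ b ℕ.* b) m)) (∣m⊝n∣≤m⊔n (a ℕ.* a ℕ.+ b ℕ.* b) m))
              (ℕ.⊔-pres-<m (ℕ.<-≤-trans (ℕ.m<m+n _ (ℕ.s≤s ℕ.z≤n)) small) (ℕ.≤-<-trans m≤n (ℕ.m<m*n n n (ℕ.nonTrivial⇒n>1 n {{prime⇒nonTrivial pr}})))))
          go₃ : ∀ y → N (+ a , + b) - + m ≡ y * + n → Dec (y ≡ 0ℤ) → QNorm (+ m) (+ n)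
          go₃ y eq (yes y≡0) = QNorm-sym (+ n) (+ m) (λ ()) (subst (QNorm (+ n)) (i-j≡0⇒i≡j (N (+ a , + b)) (+ m) (trans eq (cong (_* + n) y≡0))) (QNorm-norm (+ n) (+ a , + b)))
          go₃ y eq (no y≢0) = QNorm-cancel (+ m) (+ n) y y≢0
            (QNorm-congruence (+ m) (+ n) y a b (trans eq (*-comm y (+ n))))
            (QNorm-signed (+ m) (QNorm-neg m) y (recurse ∣ y ∣ {{≢-nonZero y≢0}} (quotient< n ∣ y ∣ _ (trans (sym (abs-* y (+ n))) (cong ∣_∣ (sym eq))) lt)))
    nz : ∀ k → .{{ℕ.NonZero k}} → + k ≢ 0ℤ
    nz (suc k) ()
    go : (m ℕ.≤ n) ⊎ (n ℕ.≤ m) → QNorm (+ m) (+ n)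
    go (inj₁ m≤n) = core m n s≡ m≤n
    go (inj₂ n≤m) = QNorm-sym (+ n) (+ m) (nz m) (core n m (trans s≡ (ℕ.+-comm m n)) n≤m)

QNorm-all : ∀ D → .{{ℕ.NonZero D}} → ∀ a → a ≢ 0ℤ → QNorm (+ D) a
QNorm-all D {{D≢0}} a a≢0 = QNorm-signed (+ D) (QNorm-neg D) a (QNorm-pos D ∣ a ∣ {{D≢0}} {{≢-nonZero a≢0}})

-- Assembling D from its primes

-- Infinite descent: p divides x, and then y because it divides D exactly once; the two quotients
-- solve the same equation.
nonsquare : ∀ D p → Prime p → + p ∣ D → ¬ + p * + p ∣ D → NonSquare D
nonsquare D p pr (divides e D≡) p²∤D x y = <-rec P step ∣ y ∣ x y refl
  where
  P : ℕ → Set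
  P n = ∀ x y → n ≡ ∣ y ∣ → x * x ≡ D * (y * y) → y ≡ 0ℤ
  p≢0 : + p ≢ 0ℤ
  p≢0 = prime≢0 pr
  p∤e : ¬ + p ∣ e
  p∤e (divides f e≡) = p²∤D (divides f (trans D≡ (trans (cong (_* + p) e≡) (*-assoc f (+ p) (+ p)))))
  step : ∀ n → (∀ {m} → m ℕ.< n → P m) → P n
  step n rec x y n≡ eq = go₁ (euclid-square pr x (divides (e * (y * y)) (trans eq (trans (cong (_* (y * y)) D≡) (lem e (+ p) (y * y))))))
    where
    lem : ∀ e p y → e * p * y ≡ e * y * p
    lem = solve-∀
    go₁ : + p ∣ x → y ≡ 0ℤ
    go₁ (divides x′ x≡) = go₂ (euclid-square pr y (go₃ (euclid pr e (y * y) (divides (x′ * x′) (sym half)))))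
      where
      half : x′ * x′ * + p ≡ e * (y * y)
      half = cancelˡ (+ p) p≢0 (trans (lem₁ x′ (+ p)) (trans (sym (cong (λ t → t * t) x≡)) (trans eq (trans (cong (_* (y * y)) D≡) (lem₂ e (+ p) (y * y))))))
        where
        lem₁ : ∀ x p → p * (x * x * p) ≡ x * p * (x * p)
        lem₁ = solve-∀
        lem₂ : ∀ e p y → e * p * y ≡ p * (e * y)
        lem₂ = solve-∀
      go₃ : (+ p ∣ e) ⊎ (+ p ∣ y * y) → + p ∣ y * y
      go₃ (inj₁ h) = contradiction h p∤e
      go₃ (inj₂ h) = h
      go₂ : + p ∣ y → y ≡ 0ℤ
      go₂ (divides y′ y≡) = go₄ (y ≟ 0ℤ)
        where
        eq′ : x′ * x′ ≡ D * (y′ * y′)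
        eq′ = cancelˡ (+ p) p≢0 (trans (*-comm (+ p) (x′ * x′)) (trans half (trans (cong (λ t → e * (t * t)) y≡) (trans (lem₁ e (+ p) y′) (cong (λ t → + p * (t * (y′ * y′))) (sym D≡))))))
          where
          lem₁ : ∀ e p y → e * (y * p * (y * p)) ≡ p * (e * p * (y * y))
          lem₁ = solve-∀
        go₄ : Dec (y ≡ 0ℤ) → y ≡ 0ℤ
        go₄ (yes h) = h
        go₄ (no y≢0) = trans y≡ (cong (_* + p) (rec small x′ y′ refl eq′))
          where
          y′≢0 : y′ ≢ 0ℤ
          y′≢0 h = y≢0 (trans y≡ (cong (_* + p) h))
          small : ∣ y′ ∣ ℕ.< n
          small = subst (∣ y′ ∣ ℕ.<_) (sym (trans n≡ (trans (cong ∣_∣ y≡) (abs-* y′ (+ p)))))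
            (ℕ.m<m*n ∣ y′ ∣ p {{≢-nonZero y′≢0}} (ℕ.nonTrivial⇒n>1 p {{prime⇒nonTrivial pr}}))

OddUniversal : ℕ → Set
OddUniversal D = ∀ a → ¬ + 2 ∣ a → Represents (+ D) a

inert-universal : ∀ D → {{ℕ.NonZero D}} → NonSquare (+ D) → (∀ {p} → Prime p → + p ∣ + D → ¬ Split p) →
  (∀ {p} → Prime p → ¬ + p * + p ∣ + D) → OddUniversal D
inert-universal D nonsq inert sqf a odd = go (QNorm-all D a (λ a≡0 → odd (divides 0ℤ a≡0)))
  where
  open OddCancellation D nonsq inert sqf
  go : QNorm (+ D) a → Represents (+ D) a
  go (α , β , γ , γ≢0 , eq) = cancel-norm γ a γ≢0 odd (α , β , eq)

-- N(1 + δβ) − N(δβ) = 1 + 2 Re(δβ), and Re(δβ) is arbitrary since δ divides r + i.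
split-universal : ∀ {p} → Prime p → Split p → OddUniversal p
split-universal {p} pr (r , d) a odd = go (divisor-of-r+i p {{prime⇒nonZero pr}} r d) (odd-decomp a odd)
  where
  go : (∃₂ λ z w → z ⊗ w ≡ (r , 1ℤ) × N z ≡ + p) → (∃ λ k → a ≡ 1ℤ + + 2 * k) → Represents (+ p) a
  go ((c , e) , (u , v) , zw , Nz) (k , a≡) = (1ℤ + (c * (k * v) - e * - (k * u)) , c * - (k * u) + e * (k * v)) , (k * v , - (k * u)) ,
    trans (cong (λ t → N α - t * N (k * v , - (k * u))) (sym Nz)) (trans (lem c e (k * v) (- (k * u)))
      (trans (cong (λ t → 1ℤ + + 2 * t) (trans (lem₂ c e u v k) (trans (cong (k *_) (cong proj₂ zw)) (*-identityʳ k)))) (sym a≡)))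
    where
    α : G
    α = 1ℤ + (c * (k * v) - e * - (k * u)) , c * - (k * u) + e * (k * v)
    lem : ∀ c e x y → (1ℤ + (c * x - e * y)) * (1ℤ + (c * x - e * y)) + (c * y + e * x) * (c * y + e * x) - (c * c + e * e) * (x * x + y * y) ≡ 1ℤ + + 2 * (c * x - e * y)
    lem = solve-∀
    lem₂ : ∀ c e u v k → c * (k * v) - e * - (k * u) ≡ k * (c * v + e * u)
    lem₂ = solve-∀

-- Putting the prime 2 into D

even-N⇒ : ∀ x y → + 2 ∣ N (x , y) → + 2 ∣ x + y
even-N⇒ x y h = euclid-square prime[2] (x + y) (∣-lin 1ℤ (x * y) h (∣-refl {+ 2}) (lem x y))
  where
  lem : ∀ x y → (x + y) * (x + y) ≡ 1ℤ * (x * x + y * y) + x * y * + 2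
  lem = solve-∀

⇒even-N : ∀ x y → + 2 ∣ x + y → + 2 ∣ N (x , y)
⇒even-N x y h = ∣-lin (x + y) (- (x * y)) h (∣-refl {+ 2}) (lem x y)
  where
  lem : ∀ x y → x * x + y * y ≡ (x + y) * (x + y) + - (x * y) * + 2
  lem = solve-∀

-- For e + f even, multiplication by e + fi + j exchanges the parities of N(α) and N(β).
record Twist (D : ℤ) : Set where
  field
    e f u v : ℤ
    even : + 2 ∣ e + f
    norm : Q D (e , f) (1ℤ , 0ℤ) ≡ N (u , v)
    odd : ¬ + 2 ∣ N (u , v)
    coprime : ∀ p → Prime p → + p ∣ u → + p ∣ v → ¬ + p ∣ + 2 → ⊥

-- For D = 4k + 1, take e² - u² = D with e = (D + 1)/2 and f = v = 1. For D = 4k + 3 that e is even,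
-- so f would be even too, and f = v = 0 would leave u and v with common factors; e² - u² = D + 4
-- allows v = 2 with f = 0.
twist : ∀ D → ¬ + 2 ∣ D → Twist D
twist D D-odd = go (odd-decomp D D-odd)
  where
  2∤1 : ¬ + 2 ∣ 1ℤ
  2∤1 = prime∤1 prime[2]
  go₂ : ∀ j → D ≡ 1ℤ + + 2 * j → (∃ λ k → j ≡ + 2 * k) ⊎ (∃ λ k → j ≡ 1ℤ + + 2 * k) → Twist D
  go₂ j D≡ (inj₁ (k , j≡)) = record
    { e = + 2 * k + 1ℤ ; f = 1ℤ ; u = + 2 * k ; v = 1ℤ
    ; even = divides (k + 1ℤ) (lem₁ k)
    ; norm = trans (cong (λ t → N (+ 2 * k + 1ℤ , 1ℤ) - t * 1ℤ) (trans D≡ (cong (λ t → 1ℤ + + 2 * t) j≡))) (lem₂ k)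
    ; odd = λ h → 2∤1 (∣-lin 1ℤ (- (+ 2 * k * k)) h (∣-refl {+ 2}) (lem₃ k))
    ; coprime = λ p pr _ h _ → prime∤1 pr h }
    where
    lem₁ : ∀ k → + 2 * k + 1ℤ + 1ℤ ≡ (k + 1ℤ) * + 2
    lem₁ = solve-∀
    lem₂ : ∀ k → (+ 2 * k + 1ℤ) * (+ 2 * k + 1ℤ) + 1ℤ - (1ℤ + + 2 * (+ 2 * k)) * 1ℤ ≡ + 2 * k * (+ 2 * k) + 1ℤ
    lem₂ = solve-∀
    lem₃ : ∀ k → 1ℤ ≡ 1ℤ * (+ 2 * k * (+ 2 * k) + 1ℤ) + - (+ 2 * k * k) * + 2
    lem₃ = solve-∀
  go₂ j D≡ (inj₂ (k , j≡)) = record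
    { e = + 2 * k + + 4 ; f = 0ℤ ; u = + 2 * k + + 3 ; v = + 2
    ; even = divides (k + + 2) (lem₁ k)
    ; norm = trans (cong (λ t → N (+ 2 * k + + 4 , 0ℤ) - t * 1ℤ) (trans D≡ (cong (λ t → 1ℤ + + 2 * t) j≡))) (lem₂ k)
    ; odd = λ h → 2∤1 (∣-lin 1ℤ (- (+ 2 * k * k + + 6 * k + + 6)) h (∣-refl {+ 2}) (lem₃ k))
    ; coprime = λ p pr _ h p∤2 → p∤2 h }
    where
    lem₁ : ∀ k → + 2 * k + + 4 + 0ℤ ≡ (k + + 2) * + 2
    lem₁ = solve-∀
    lem₂ : ∀ k → (+ 2 * k + + 4) * (+ 2 * k + + 4) + 0ℤ - (1ℤ + + 2 * (1ℤ + + 2 * k)) * 1ℤ ≡ (+ 2 * k + + 3) * (+ 2 * k + + 3) + + 4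
    lem₂ = solve-∀
    lem₃ : ∀ k → 1ℤ ≡ 1ℤ * ((+ 2 * k + + 3) * (+ 2 * k + + 3) + + 4) + - (+ 2 * k * k + + 6 * k + + 6) * + 2
    lem₃ = solve-∀
  go : (∃ λ j → D ≡ 1ℤ + + 2 * j) → Twist D
  go (j , D≡) = go₂ j D≡ (parity j)

-- If N(β) is even, dividing β by 1 + i turns D into 2D. If it is odd, N(α) is even because a and D
-- are odd; the twist exchanges the parities, and the odd factor N(u, v) it brings in is cancelled
-- in the form for 2D.
double-universal : ∀ D → {{ℕ.NonZero (D ℕ.* 2)}} → NonSquare (+ (D ℕ.* 2)) → ¬ + 2 ∣ + D →
  (∀ {p} → Prime p → ¬ + p ∣ + 2 → Split p → ¬ + p ∣ + (D ℕ.* 2)) → OddUniversal D → OddUniversal (D ℕ.* 2)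
double-universal D nonsq D-odd no-split univ a a-odd = go (univ a a-odd) (twist (+ D) D-odd)
  where
  open Cancellation (D ℕ.* 2) nonsq no-split
  halve : ∀ α β n → Q (+ D) α β ≡ n → + 2 ∣ N β → Represents (+ (D ℕ.* 2)) n
  halve α β n eq h = go′ (split-norm prime[2] (1ℤ , 1ℤ) β refl h)
    where
    go′ : (∃ λ w → N β ≡ + 2 * N w) → Represents (+ (D ℕ.* 2)) n
    go′ (w , w≡) = α , w , trans (cong (λ t → N α - t) (trans (cong (_* N w) (pos-* D 2)) (trans (*-assoc (+ D) (+ 2) (N w)) (cong (+ D *_) (sym w≡))))) eq
  go : Represents (+ D) a → Twist (+ D) → Represents (+ (D ℕ.* 2)) a
  go (α@(x , y) , β@(s , t) , eq) tw = go₂ (+ 2 ∣? N β)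
    where
    open Twist tw
    g = qmul (+ D) (α , β) ((e , f) , (1ℤ , 0ℤ))
    go₂ : Dec (+ 2 ∣ N β) → Represents (+ (D ℕ.* 2)) a
    go₂ (yes h) = halve α β a eq h
    go₂ (no h) = cancel-coprime-norm u v odd coprime a (halve (proj₁ g) (proj₂ g) (N (u , v) * a)
        (trans (Q-mul (+ D) (α , β) ((e , f) , (1ℤ , 0ℤ))) (trans (cong₂ _*_ eq norm) (*-comm a (N (u , v))))) β″-even)
      where
      α-even : + 2 ∣ N α
      α-even = go₃ (odd-decomp a a-odd) (odd-decomp (+ D * N β) (∤-* prime[2] D-odd h))
        where
        lem : ∀ i j → 1ℤ + + 2 * i + (1ℤ + + 2 * j) ≡ (i + j + 1ℤ) * + 2
        lem = solve-∀
        lem₁ : ∀ u v → u ≡ u - v + v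
        lem₁ = solve-∀
        go₃ : (∃ λ i → a ≡ 1ℤ + + 2 * i) → (∃ λ j → + D * N β ≡ 1ℤ + + 2 * j) → + 2 ∣ N α
        go₃ (i , i≡) (j , j≡) = divides (i + j + 1ℤ) (trans (lem₁ (N α) (+ D * N β)) (trans (cong₂ _+_ (trans eq i≡) j≡) (lem i j)))
      β″-even : + 2 ∣ N (proj₂ g)
      β″-even = ⇒even-N (x * 1ℤ - y * 0ℤ + (s * e + t * f)) (x * 0ℤ + y * 1ℤ + (t * e - s * f))
        (∣-lin₃ 1ℤ (s + t) (- (s * f)) (even-N⇒ x y α-even) even (∣-refl {+ 2}) (lem x y s t e f))
        where
        lem : ∀ x y s t e f → x * 1ℤ - y * 0ℤ + (s * e + t * f) + (x * 0ℤ + y * 1ℤ + (t * e - s * f)) ≡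
          1ℤ * (x + y) + (s + t) * (e + f) + - (s * f) * + 2
        lem = solve-∀

-- Induction over the prime factors of D

squarefree-ℤ : ∀ {D} → SquareFree D → ∀ {p} → Prime p → ¬ + p * + p ∣ + D
squarefree-ℤ {D} sqf {p} pr d = sqf p pr (subst (ℕᵈ._∣ D) (abs-* (+ p) (+ p)) (∣⇒∣ᵤ d))

squarefree-divisor : ∀ {D J} → J ℕᵈ.∣ D → SquareFree D → SquareFree J
squarefree-divisor J∣D sqf p pr d = sqf p pr (ℕᵈ.∣-trans d J∣D)

squarefree-nonsquare : ∀ D → 2 ℕ.≤ D → SquareFree D → NonSquare (+ D)
squarefree-nonsquare D@(suc _) D≥2 sqf = go (prime-divisor D)
  where
  go : D ≡ 1 ⊎ (∃ λ p → Prime p × p ℕᵈ.∣ D) → NonSquare (+ D)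
  go (inj₁ eq) = contradiction D≥2 (ℕ.<⇒≱ (ℕ.s≤s (ℕ.≤-reflexive eq)))
  go (inj₂ (p , pr , d)) = nonsquare (+ D) p pr (∣ᵤ⇒∣ d) (squarefree-ℤ sqf pr)

OddSplitFactor : ℕ → ℕ → Set
OddSplitFactor D p = Prime p × p ℕᵈ.∣ D × p ≢ 2 × Split p

oddSplitFactor? : ∀ D p → Dec (OddSplitFactor D p)
oddSplitFactor? D zero = no (λ h → ¬prime[0] (proj₁ h))
oddSplitFactor? D p@(suc _) = prime? p ×-dec p ℕᵈ.∣? D ×-dec ¬? (p ℕ.≟ 2) ×-dec split? p

-- Odd split primes are peeled off by strong induction on D. What is left has inert primes only,
-- apart from a possible factor 2.
odd-universal : ∀ D → 2 ℕ.≤ D → SquareFree D → OddUniversal D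
odd-universal = <-rec (λ D → 2 ℕ.≤ D → SquareFree D → OddUniversal D) step
  where
  step : ∀ D → (∀ {J} → J ℕ.< D → 2 ℕ.≤ J → SquareFree J → OddUniversal J) → 2 ℕ.≤ D → SquareFree D → OddUniversal D
  step D@(suc _) rec D≥2 sqf = go (ℕ.anyUpTo? (oddSplitFactor? D) (suc D))
    where
    go₁ : ∀ p J → Prime p → p ≢ 2 → Split p → D ≡ J ℕ.* p → OddUniversal D
    go₁ p zero pr p≢2 sp ()
    -- The cofactor 1 is a square and has no Pell unit to absorb p with; D = p is treated directly.
    go₁ p (suc zero) pr p≢2 sp eq = subst OddUniversal (sym (trans eq (ℕ.*-identityˡ p))) (split-universal pr sp)
    go₁ p J@(suc (suc _)) pr p≢2 sp eq a odd = subst (λ t → Represents t a) (trans (sym (pos-* J p)) (cong +_ (sym eq)))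
        (absorb pr (λ d → p≢2 (∣2⇒≡2 pr d)) sp J (squarefree-nonsquare J J≥2 sqfJ) p∤J {a}
          (rec J<D J≥2 sqfJ a odd))
      where
      J≥2 : 2 ℕ.≤ J
      J≥2 = ℕ.s≤s (ℕ.s≤s ℕ.z≤n)
      sqfJ : SquareFree J
      sqfJ = squarefree-divisor (ℕᵈ.divides p (trans eq (ℕ.*-comm J p))) sqf
      J<D : J ℕ.< D
      J<D = subst (J ℕ.<_) (sym eq) (ℕ.m<m*n J p (ℕ.nonTrivial⇒n>1 p {{prime⇒nonTrivial pr}}))
      p∤J : ¬ + p ∣ + J
      p∤J d = sqf p pr (subst (p ℕ.* p ℕᵈ.∣_) (sym eq) (ℕᵈ.*-monoˡ-∣ p (∣⇒∣ᵤ d)))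
    module _ (none : ¬ (∃ λ p → p ℕ.< suc D × OddSplitFactor D p)) where
      no-split : ∀ {p} → Prime p → ¬ + p ∣ + 2 → Split p → ¬ + p ∣ + D
      no-split {p} pr p∤2 sp d = none (p , ℕ.s≤s (ℕᵈ.∣⇒≤ (∣⇒∣ᵤ d)) , pr , ∣⇒∣ᵤ d , (λ p≡2 → p∤2 (∣-reflexive (cong +_ p≡2))) , sp)
      inert-of : ∀ J → J ℕᵈ.∣ D → ¬ + 2 ∣ + J → ∀ {p} → Prime p → + p ∣ + J → ¬ Split p
      inert-of J J∣D odd {p} pr d sp = no-split pr (λ p∣2 → odd (subst (λ t → + t ∣ + J) (∣2⇒≡2 pr p∣2) d)) sp (∣-trans d (∣ᵤ⇒∣ J∣D))
      go₃ : ∀ J → D ≡ J ℕ.* 2 → OddUniversal D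
      go₃ zero ()
      go₃ (suc zero) eq = subst OddUniversal (sym eq) (split-universal prime[2] split-2)
      go₃ J@(suc (suc _)) eq = subst OddUniversal (sym eq)
        (double-universal J (subst (λ t → NonSquare (+ t)) eq (squarefree-nonsquare D D≥2 sqf)) J-odd
          (λ {p} → subst (λ t → Prime p → ¬ + p ∣ + 2 → Split p → ¬ + p ∣ + t) eq no-split)
          (inert-universal J (squarefree-nonsquare J (ℕ.s≤s (ℕ.s≤s ℕ.z≤n)) sqfJ) (inert-of J J∣D J-odd) (squarefree-ℤ sqfJ)))
        where
        J∣D : J ℕᵈ.∣ D
        J∣D = ℕᵈ.divides 2 (trans eq (ℕ.*-comm J 2))
        sqfJ : SquareFree J
        sqfJ = squarefree-divisor J∣D sqf
        J-odd : ¬ + 2 ∣ + J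
        J-odd d = sqf 2 prime[2] (subst (4 ℕᵈ.∣_) (sym eq) (ℕᵈ.*-monoˡ-∣ 2 (∣⇒∣ᵤ d)))
      go₂ : Dec (2 ℕᵈ.∣ D) → OddUniversal D
      go₂ (yes (ℕᵈ.divides J eq)) = go₃ J eq
      go₂ (no odd) = inert-universal D (squarefree-nonsquare D D≥2 sqf) (inert-of D ℕᵈ.∣-refl (λ d → odd (∣⇒∣ᵤ d))) (squarefree-ℤ sqf)
    go : Dec (∃ λ p → p ℕ.< suc D × OddSplitFactor D p) → OddUniversal D
    go (yes (p , _ , pr , ℕᵈ.divides J eq , p≢2 , sp)) = go₁ p J pr p≢2 sp eq
    go (no none) = go₂ none (2 ℕᵈ.∣? D)

-- 2 = N(1 + i) and values multiply, so an even a reduces to a / 2.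
universal : ∀ D → OddUniversal D → ∀ a → Represents (+ D) a
universal D univ a = <-rec (λ n → ∀ a → n ≡ ∣ a ∣ → Represents (+ D) a) step ∣ a ∣ a refl
  where
  step : ∀ n → (∀ {m} → m ℕ.< n → ∀ a → m ≡ ∣ a ∣ → Represents (+ D) a) → ∀ a → n ≡ ∣ a ∣ → Represents (+ D) a
  step n rec a n≡ = go (parity a) (a ≟ 0ℤ)
    where
    go : _ → Dec (a ≡ 0ℤ) → Represents (+ D) a
    go _ (yes a≡0) = subst (Represents (+ D)) (sym a≡0) (Represents-norm {+ D} (0ℤ , 0ℤ))
    go (inj₁ (k , a≡)) (no a≢0) = subst (Represents (+ D)) (sym a≡) (Represents-mul {+ D} {+ 2} {k} (Represents-norm {+ D} (1ℤ , 1ℤ)) (rec small k refl))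
      where
      k≢0 : k ≢ 0ℤ
      k≢0 k≡0 = a≢0 (trans a≡ (cong (+ 2 *_) k≡0))
      small : ∣ k ∣ ℕ.< n
      small = subst (∣ k ∣ ℕ.<_) (sym (trans n≡ (trans (cong ∣_∣ a≡) (trans (abs-* (+ 2) k) (ℕ.*-comm 2 ∣ k ∣))))) (ℕ.m<m*n ∣ k ∣ 2 {{≢-nonZero k≢0}} (ℕ.s≤s (ℕ.s≤s ℕ.z≤n)))
    go (inj₂ (k , a≡)) _ = univ a (λ d → prime∤1 prime[2] (∣-lin 1ℤ (- k) d (∣-refl {+ 2}) (trans (lem k) (cong (λ t → 1ℤ * t + - k * + 2) (sym a≡)))))
      where
      lem : ∀ k → 1ℤ ≡ 1ℤ * (1ℤ + + 2 * k) + - k * + 2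
      lem = solve-∀

-- Transfer from integer pairs to K

ℤ→ℚ-+ : ∀ a b → ℤ→ℚ a ℚ.+ ℤ→ℚ b ≡ ℤ→ℚ (a + b)
ℤ→ℚ-+ a b = ℚ.toℚᵘ-injective (ℚᵘ.≃-trans (ℚ.toℚᵘ-homo-+ (ℤ→ℚ a) (ℤ→ℚ b))
  (ℚᵘ.≃-trans (ℚᵘ.+-cong (ℚ.toℚᵘ-fromℚᵘ (mkℚᵘ a 0)) (ℚ.toℚᵘ-fromℚᵘ (mkℚᵘ b 0)))
    (ℚᵘ.≃-trans (*≡* (lem a b)) (ℚᵘ.≃-sym (ℚ.toℚᵘ-fromℚᵘ (mkℚᵘ (a + b) 0))))))
  where
  lem : ∀ a b → (a * 1ℤ + b * 1ℤ) * 1ℤ ≡ (a + b) * 1ℤ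
  lem = solve-∀

ℤ→ℚ-* : ∀ a b → ℤ→ℚ a ℚ.* ℤ→ℚ b ≡ ℤ→ℚ (a * b)
ℤ→ℚ-* a b = ℚ.toℚᵘ-injective (ℚᵘ.≃-trans (ℚ.toℚᵘ-homo-* (ℤ→ℚ a) (ℤ→ℚ b))
  (ℚᵘ.≃-trans (ℚᵘ.*-cong (ℚ.toℚᵘ-fromℚᵘ (mkℚᵘ a 0)) (ℚ.toℚᵘ-fromℚᵘ (mkℚᵘ b 0)))
    (ℚᵘ.≃-sym (ℚ.toℚᵘ-fromℚᵘ (mkℚᵘ (a * b) 0)))))

ℤ→ℚ-neg : ∀ a → ℚ.- ℤ→ℚ a ≡ ℤ→ℚ (- a)
ℤ→ℚ-neg a = ℚ.toℚᵘ-injective (ℚᵘ.≃-trans (ℚ.toℚᵘ-homo‿- (ℤ→ℚ a))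
  (ℚᵘ.≃-trans (ℚᵘ.-‿cong (ℚ.toℚᵘ-fromℚᵘ (mkℚᵘ a 0))) (ℚᵘ.≃-sym (ℚ.toℚᵘ-fromℚᵘ (mkℚᵘ (- a) 0)))))

module _ (D : ℕ) where
  open QuadField D

  ι : ℤ × ℤ → K
  ι (x , y) = ℤ→ℚ x , ℤ→ℚ y

  _·_ : ℤ × ℤ → ℤ × ℤ → ℤ × ℤ
  (a , b) · (c , d) = a * c + + D * (b * d) , a * d + b * c

  ι-+ : ∀ x y → ι x +K ι y ≡ ι (proj₁ x + proj₁ y , proj₂ x + proj₂ y)
  ι-+ (a , b) (c , d) = cong₂ _,_ (ℤ→ℚ-+ a c) (ℤ→ℚ-+ b d)

  ι-* : ∀ x y → ι x *K ι y ≡ ι (x · y)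
  ι-* (a , b) (c , d) = cong₂ _,_
    (trans (cong₂ ℚ._+_ (ℤ→ℚ-* a c) (trans (cong (Dℚ ℚ.*_) (ℤ→ℚ-* b d)) (ℤ→ℚ-* (+ D) (b * d)))) (ℤ→ℚ-+ (a * c) (+ D * (b * d))))
    (trans (cong₂ ℚ._+_ (ℤ→ℚ-* a d) (ℤ→ℚ-* b c)) (ℤ→ℚ-+ (a * d) (b * c)))

  ι-τ : ∀ x y → τ (ι (x , y)) ≡ ι (x , - y)
  ι-τ x y = cong (ℤ→ℚ x ,_) (ℤ→ℚ-neg y)

  -- x + y√D is a root of its characteristic polynomial X² - 2xX + (x² - Dy²); `c` lists the
  -- coefficients below the leading one.
  ι-integral : ∀ x y → IsAlgInt (ι (x , y))
  ι-integral x y = 2 , c , trans (cong₂ _+K_ square poly) (trans (ι-+ (z · (z · (1ℤ , 0ℤ))) _) (cong₂ (λ s t → ι (s , t)) (lem₁ (+ D) x y) (lem₂ (+ D) x y)))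
    where
    z : ℤ × ℤ
    z = x , y
    c₀ c₁ : ℤ
    c₀ = x * x - + D * (y * y)
    c₁ = - (x + x)
    c : Fin 2 → ℤ
    c Fin.zero = c₀
    c (Fin.suc _) = c₁
    inner outer : ℤ × ℤ
    inner = proj₁ ((c₁ , 0ℤ) · (1ℤ , 0ℤ)) + proj₁ (z · (0ℤ , 0ℤ)) , proj₂ ((c₁ , 0ℤ) · (1ℤ , 0ℤ)) + proj₂ (z · (0ℤ , 0ℤ))
    outer = proj₁ ((c₀ , 0ℤ) · (1ℤ , 0ℤ)) + proj₁ (z · inner) , proj₂ ((c₀ , 0ℤ) · (1ℤ , 0ℤ)) + proj₂ (z · inner)
    square : ι z ^K 2 ≡ ι (z · (z · (1ℤ , 0ℤ)))
    square = trans (cong (ι z *K_) (ι-* z (1ℤ , 0ℤ))) (ι-* z (z · (1ℤ , 0ℤ)))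
    poly₁ : polySum 1 (λ i → c (Fin.suc i)) (ι z) ≡ ι inner
    poly₁ = trans (cong₂ _+K_ (ι-* (c₁ , 0ℤ) (1ℤ , 0ℤ)) (ι-* z (0ℤ , 0ℤ))) (ι-+ ((c₁ , 0ℤ) · (1ℤ , 0ℤ)) (z · (0ℤ , 0ℤ)))
    poly : polySum 2 c (ι z) ≡ ι outer
    poly = trans (cong₂ _+K_ (ι-* (c₀ , 0ℤ) (1ℤ , 0ℤ)) (trans (cong (ι z *K_) poly₁) (ι-* z inner))) (ι-+ ((c₀ , 0ℤ) · (1ℤ , 0ℤ)) (z · inner))
    lem₁ : ∀ D x y →
      x * (x * 1ℤ + D * (y * 0ℤ)) + D * (y * (x * 0ℤ + y * 1ℤ)) +
      ((x * x - D * (y * y)) * 1ℤ + D * (0ℤ * 0ℤ) +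
        (x * ((- (x + x)) * 1ℤ + D * (0ℤ * 0ℤ) + (x * 0ℤ + D * (y * 0ℤ))) + D * (y * ((- (x + x)) * 0ℤ + 0ℤ * 1ℤ + (x * 0ℤ + y * 0ℤ))))) ≡ 0ℤ
    lem₁ = solve-∀
    lem₂ : ∀ D x y →
      x * (x * 0ℤ + y * 1ℤ) + y * (x * 1ℤ + D * (y * 0ℤ)) +
      ((x * x - D * (y * y)) * 0ℤ + 0ℤ * 1ℤ +
        (x * ((- (x + x)) * 0ℤ + 0ℤ * 1ℤ + (x * 0ℤ + y * 0ℤ)) + y * ((- (x + x)) * 1ℤ + D * (0ℤ * 0ℤ) + (x * 0ℤ + D * (y * 0ℤ))))) ≡ 0ℤ
    lem₂ = solve-∀

  ι-norm : ∀ x y → ι (x , y) *K τ (ι (x , y)) ≡ ι ((x , y) · (x , - y))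
  ι-norm x y = trans (cong (ι (x , y) *K_) (ι-τ x y)) (ι-* (x , y) (x , - y))

  sum-of-norms : ∀ a → Represents (+ D) a → ∃ λ z → ∃ λ w → IsAlgInt z × IsAlgInt w × ((z *K τ z) +K (w *K τ w)) ≡ fromℚ (ℤ→ℚ a)
  sum-of-norms a ((x , u) , (y , v) , eq) = ι (x , y) , ι (u , v) , ι-integral x y , ι-integral u v ,
    trans (cong₂ _+K_ (ι-norm x y) (ι-norm u v)) (trans (ι-+ ((x , y) · (x , - y)) ((u , v) · (u , - v)))
      (cong₂ (λ s t → ι (s , t)) (trans (lem₁ (+ D) x y u v) eq) (lem₂ x y u v)))
    where
    lem₁ : ∀ D x y u v → x * x + D * (y * - y) + (u * u + D * (v * - v)) ≡ x * x + u * u - D * (y * y + v * v)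
    lem₁ = solve-∀
    lem₂ : ∀ x y u v → x * - y + y * x + (u * - v + v * u) ≡ 0ℤ
    lem₂ = solve-∀

theorem6p6 : (D : ℕ) → D ≥ 2 → SquareFree D →
    let open QuadField D in
    (a : ℤ) → ∃[ z ] ∃[ w ] (IsAlgInt z × IsAlgInt w ×
    ((z *K τ z) +K (w *K τ w)) ≡ fromℚ (ℤ→ℚ a))
theorem6p6 D D≥2 sqf a = sum-of-norms D a (universal D (odd-universal D D≥2 sqf) a)
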